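{- Let $n\ge 7$. If $G$ and $H$ are graphs on $n$ vertices with the same $(n-3)$-deck, i.e. $\mathcal{D}_{n-3}(G)=\mathcal{D}_{n-3}(H)$, then $G$ and $H$ have the same degree list (multiset of vertex degrees). Moreover, the threshold on $n$ is sharp: there exist two graphs on $6$ vertices with the same $3$-deck but different degree lists.
   Context: All graphs are finite and simple. For a graph $G$, a $k$-card of $G$ is an induced subgraph of $G$ on $k$ vertices, considered up to isomorphism. The $k$-deck $\mathcal{D}_k(G)$ is the multiset of all $k$-cards of $G$ (one for each $k$-element vertex subset). -}

module Defs where

open import Data.Bool.Base using (Bool; false)
open import Data.Fin.Base using (Fin)
open import Data.Fin.Permutation using (Permutation; _⟨$⟩ʳ_; _⟨$⟩ˡ_; inverseʳ; id; flip; _∘ₚ_)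
open import Data.Fin.Subset using (Subset; ∣_∣)
open import Data.List.Base using (List; []; _∷_; _++_; map; allFin)
open import Data.Nat.Base using (ℕ; zero; suc)
open import Data.Vec.Base using (Vec; []; _∷_; lookup; tabulate)
open import Level using (0ℓ)
open import Relation.Binary.Bundles using (Setoid)
open import Relation.Binary.PropositionalEquality.Core using (_≡_; refl; sym; trans; cong₂)
import Data.List.Relation.Binary.Permutation.Propositional as PermutationPropositional
import Data.List.Relation.Binary.Permutation.Setoid as PermutationSetoid

record Graph (n : ℕ) : Set where
  field
    adj        : Fin n → Fin n → Bool
    adj-sym    : ∀ u v → adj u v ≡ adj v u
    adj-irrefl : ∀ v → adj v v ≡ false

open Graph public

infix 4 _≅_

record _≅_ {n : ℕ} (G H : Graph n) : Set where
  field
    bij      : Permutation n n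
    adj-pres : ∀ u v → adj G u v ≡ adj H (bij ⟨$⟩ʳ u) (bij ⟨$⟩ʳ v)

open _≅_ public

≅-refl : ∀ {n} {G : Graph n} → G ≅ G
≅-refl = record { bij = id ; adj-pres = λ _ _ → refl }

≅-sym : ∀ {n} {G H : Graph n} → G ≅ H → H ≅ G
≅-sym {H = H} e = record
  { bij      = flip (bij e)
  ; adj-pres = λ u v → sym (trans (adj-pres e (bij e ⟨$⟩ˡ u) (bij e ⟨$⟩ˡ v))
                                  (cong₂ (adj H) (inverseʳ (bij e)) (inverseʳ (bij e))))
  }

≅-trans : ∀ {n} {G H K : Graph n} → G ≅ H → H ≅ K → G ≅ K
≅-trans e f = record
  { bij      = bij e ∘ₚ bij f
  ; adj-pres = λ u v → trans (adj-pres e u v)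
                             (adj-pres f (bij e ⟨$⟩ʳ u) (bij e ⟨$⟩ʳ v))
  }

≅-setoid : ℕ → Setoid 0ℓ 0ℓ
≅-setoid n = record
  { Carrier       = Graph n
  ; _≈_           = _≅_
  ; isEquivalence = record { refl = ≅-refl ; sym = ≅-sym ; trans = ≅-trans }
  }

-- The choices of k positions of a list, each listed once, in increasing order.
combinations : ∀ {A : Set} (k : ℕ) → List A → List (Vec A k)
combinations zero    xs       = [] ∷ []
combinations (suc k) []       = []
combinations (suc k) (x ∷ xs) = map (x ∷_) (combinations k xs) ++ combinations (suc k) xs

-- A k-element vertex subset is represented by the increasing vector of its
-- elements; vertex i of the induced subgraph is the i-th element.
kSubsets : (k n : ℕ) → List (Vec (Fin n) k)
kSubsets k n = combinations k (allFin n)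

induced : ∀ {n k} → Graph n → Vec (Fin n) k → Graph k
induced G S = record
  { adj        = λ i j → adj G (lookup S i) (lookup S j)
  ; adj-sym    = λ i j → adj-sym G (lookup S i) (lookup S j)
  ; adj-irrefl = λ i → adj-irrefl G (lookup S i)
  }

deck : ∀ {n} (k : ℕ) → Graph n → List (Graph k)
deck {n} k G = map (induced G) (kSubsets k n)

-- Equality of decks as multisets of isomorphism classes: the lists agree up to
-- reordering and replacement of cards by isomorphic ones.
SameDeck : ∀ {n} (k : ℕ) → Graph n → Graph n → Set
SameDeck k G H = deck k G ↭ deck k H
  where open PermutationSetoid (≅-setoid k) using (_↭_)

neighbourhood : ∀ {n} → Graph n → Fin n → Subset n
neighbourhood G v = tabulate (adj G v)

degree : ∀ {n} → Graph n → Fin n → ℕ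
degree G v = ∣ neighbourhood G v ∣

degreeList : ∀ {n} → Graph n → List ℕ
degreeList {n} G = map (degree G) (allFin n)

SameDegreeList : ∀ {n} → Graph n → Graph n → Set
SameDegreeList G H = degreeList G ↭ degreeList H
  where open PermutationPropositional using (_↭_)

{-# OPTIONS --safe #-}
-- Counting pairs of a card and a vertex on it shows that the (n − 3)-deck determines Σ_v C(deg v , j) for j ≤ n − 4.
-- With m = n − 3 and x_d the difference of the numbers of vertices of degree d in G and H, this says
-- Σ_d x_d t^d = (1 − t)^m (α + β t + γ t²) with integers α, β, γ, while Σ_d |x_d| ≤ 2n.  At t = −1 the absolute value
-- of the left side is at most 2n < 2^m, so α − β + γ = 0.  For n ≥ 8 testing against (−1)^d times a linear and a
-- quadratic polynomial in d (against sign vectors if n = 8 or 9) gives α = γ and then α = 0.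
-- For n = 7 up to exchanging G and H and complementation two nonzero solutions survive.  In (1 − t²)²(1 − t)², G would
-- have both an isolated and a dominating vertex.  In (1 − t)⁴(1 + t), the Erdős–Gallai inequality pins down the
-- degrees of H and shows that H has a 4-clique and an independent 4-set; then so has G, hence G is a split graph, and
-- its 4-clique has a larger degree sum than any four vertices of G can have.
module Submission where

open import Defs
open import Data.Nat.Base using (ℕ; _≤_; _∸_)
open import Data.Product.Base using (_×_; Σ-syntax)
open import Relation.Nullary.Negation.Core using (¬_)

open import Algebra.Properties.CommutativeSemigroup using (interchange; x∙yz≈y∙xz)
import Algebra.Properties.Semiring.Sum as SemiringSum
open import Data.Bool.Base as Bool using (Bool; true; false; not; if_then_else_; _∧_; _∨_)
open import Data.Bool.ListAction using (any)
open import Data.Bool.Properties using () renaming (_≟_ to _≟ᵇ_)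
open import Data.Empty using (⊥-elim)
open import Data.Fin.Base using (Fin; zero; suc; toℕ)
open import Data.Fin.Patterns
open import Data.Fin.Permutation using (Permutation; transpose; _⟨$⟩ʳ_) renaming (id to idₚ)
open import Data.Fin.Properties using (all?) renaming (_≟_ to _≟ᶠ_)
import Data.Fin.Subset as Subset
open import Data.Integer.Base as ℤ using (ℤ; +_; -[1+_]; 0ℤ; 1ℤ; -1ℤ; ∣_∣)
import Data.Integer.Properties as ℤ
import Data.Integer.Tactic.RingSolver as ℤ-Solver
open import Data.List.Base as List using (List; []; _∷_; _++_; map; length; replicate; allFin)
open import Data.List.Membership.Propositional using (_∈_)
open import Data.List.Membership.Propositional.Properties using (∈-∃++; ∈-map⁻)
open import Data.List.Properties using (map-++; map-tabulate; length-map; length-tabulate)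
import Data.List.Relation.Binary.Permutation.Homogeneous as Homogeneous
open import Data.List.Relation.Binary.Permutation.Propositional as ↭ using (_↭_; ↭-trans; ↭-sym; ↭-prep; ↭⇒↭ₛ)
open import Data.List.Relation.Binary.Permutation.Propositional.Properties using (shift; ++⁺ˡ; ↭-length)
import Data.List.Relation.Binary.Permutation.Setoid.Properties as Setoid↭
open import Data.List.Relation.Binary.Pointwise.Base using (Pointwise; []; _∷_)
open import Data.List.Relation.Unary.All as All using (All; []; _∷_)
import Data.List.Relation.Unary.All.Properties as All
open import Data.List.Relation.Unary.Any as Any using (Any; here; there)
import Data.List.Relation.Unary.Any.Properties as Any
open import Data.Nat.Base as ℕ using (zero; suc; _+_; _*_; _^_; _<_; z≤n; s≤s; s≤s⁻¹; _≡ᵇ_; _≤ᵇ_; >-nonZero)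
open import Data.Nat.Combinatorics using (_C_; nCk+nC[k+1]≡[n+1]C[k+1]; k>n⇒nCk≡0)
open import Data.Nat.ListAction using (sum)
open import Data.Nat.ListAction.Properties using (sum-++)
open import Data.Nat.Properties
open import Data.Nat.Tactic.RingSolver using (solve-∀)
open import Data.Product.Base using (_,_; proj₁; uncurry; map₂; ∃)
open import Data.Sum.Base using (_⊎_; inj₁; inj₂; [_,_]′)
open import Data.Unit.Base using (tt)
open import Data.Vec.Base using (Vec; []; _∷_; lookup; tabulate; toList)
open import Function.Base using (_∘_; id; const)
open import Relation.Binary.PropositionalEquality
open import Relation.Nullary.Decidable.Core using (yes; no; True; toWitness; from-no; isYes)
open import Relation.Nullary.Negation.Core using (contradiction)

module ∑  = SemiringSum +-*-semiring
module ∑ℤ = SemiringSum ℤ.+-*-semiring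

private variable
  A B : Set
  n k : ℕ

-- Sums over lists and vertex sets

χ : Bool → ℕ
χ b = if b then 1 else 0

sumOver : (A → ℕ) → List A → ℕ
sumOver f xs = sum (map f xs)

count : (A → Bool) → List A → ℕ
count p = sumOver (χ ∘ p)

sumOver-++ : ∀ (f : A → ℕ) xs ys → sumOver f (xs ++ ys) ≡ sumOver f xs + sumOver f ys
sumOver-++ f xs ys = trans (cong sum (map-++ f xs ys)) (sum-++ (map f xs) (map f ys))

sumOver-map : ∀ (f : B → ℕ) (g : A → B) xs → sumOver f (map g xs) ≡ sumOver (f ∘ g) xs
sumOver-map f g []       = refl
sumOver-map f g (x ∷ xs) = cong (f (g x) ℕ.+_) (sumOver-map f g xs)

sumOver-cong : ∀ {f g : A → ℕ} → f ≗ g → sumOver f ≗ sumOver g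
sumOver-cong f≗g []       = refl
sumOver-cong f≗g (x ∷ xs) = cong₂ _+_ (f≗g x) (sumOver-cong f≗g xs)

sumOver-cong-local : ∀ {f g : A → ℕ} {xs} → All (λ x → f x ≡ g x) xs → sumOver f xs ≡ sumOver g xs
sumOver-cong-local []         = refl
sumOver-cong-local (eq ∷ eqs) = cong₂ _+_ eq (sumOver-cong-local eqs)

sumOver-+ : ∀ (f g : A → ℕ) xs → sumOver (λ x → f x + g x) xs ≡ sumOver f xs + sumOver g xs
sumOver-+ f g []       = refl
sumOver-+ f g (x ∷ xs) = trans (cong (f x + g x ℕ.+_) (sumOver-+ f g xs))
  (interchange +-commutativeSemigroup (f x) (g x) _ _)

sumOver-*ʳ : ∀ (f : A → ℕ) c xs → sumOver (λ x → f x * c) xs ≡ sumOver f xs * c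
sumOver-*ʳ f c []       = refl
sumOver-*ʳ f c (x ∷ xs) = trans (cong (f x * c ℕ.+_) (sumOver-*ʳ f c xs)) (sym (*-distribʳ-+ c (f x) _))

sumOver-allFin : ∀ {n} (f : Fin n → ℕ) → sumOver f (allFin n) ≡ ∑.sum f
sumOver-allFin {n} f = trans (cong sum (map-tabulate (λ i → i) f)) (go f)
  where
  go : ∀ {n} (f : Fin n → ℕ) → sum (List.tabulate f) ≡ ∑.sum f
  go {zero}  f = refl
  go {suc n} f = cong (f zero ℕ.+_) (go (f ∘ suc))

sumOver-toList : ∀ {k} (f : A → ℕ) (S : Vec A k) → sumOver f (toList S) ≡ ∑.sum (f ∘ lookup S)
sumOver-toList f []       = refl
sumOver-toList f (x ∷ S) = cong (f x ℕ.+_) (sumOver-toList f S)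

∣tabulate∣ : ∀ {n} (p : Fin n → Bool) → Subset.∣ tabulate p ∣ ≡ ∑.sum (χ ∘ p)
∣tabulate∣ {zero}  p = refl
∣tabulate∣ {suc n} p with p zero
... | true  = cong suc (∣tabulate∣ (p ∘ suc))
... | false = ∣tabulate∣ (p ∘ suc)

degree-∑ : ∀ {n} (G : Graph n) v → degree G v ≡ ∑.sum (χ ∘ adj G v)
degree-∑ G v = ∣tabulate∣ (adj G v)

degree-≅ : ∀ {n} {G H : Graph n} (e : G ≅ H) v → degree G v ≡ degree H (bij e ⟨$⟩ʳ v)
degree-≅ {G = G} {H} e v = begin
  degree G v                               ≡⟨ degree-∑ G v ⟩
  ∑.sum (χ ∘ adj G v)                      ≡⟨ ∑.sum-cong-≗ (λ u → cong χ (adj-pres e v u)) ⟩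
  ∑.sum (λ u → χ (adj H w (bij e ⟨$⟩ʳ u))) ≡⟨ ∑.sum-permute (χ ∘ adj H w) (bij e) ⟨
  ∑.sum (χ ∘ adj H w)                      ≡⟨ degree-∑ H w ⟨
  degree H w                               ∎
  where
  open ≡-Reasoning
  w = bij e ⟨$⟩ʳ v

-- Double counting over k-element subsets

picks : List A → List (A × List A)
picks []       = []
picks (x ∷ xs) = (x , xs) ∷ map (map₂ (x ∷_)) (picks xs)

sumOver-picks-proj₁ : ∀ (f : A → ℕ) xs → sumOver (f ∘ proj₁) (picks xs) ≡ sumOver f xs
sumOver-picks-proj₁ f []       = refl
sumOver-picks-proj₁ f (x ∷ xs) = cong (f x ℕ.+_)
  (trans (sumOver-map (f ∘ proj₁) (map₂ (x ∷_)) (picks xs)) (sumOver-picks-proj₁ f xs))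

sumOver-pick : ∀ xs → All (λ (v , ys) → ∀ (f : A → ℕ) → sumOver f xs ≡ f v + sumOver f ys) (picks xs)
sumOver-pick []       = []
sumOver-pick (x ∷ xs) = (λ f → refl) ∷ All.map⁺ (All.map
  (λ {(v , ys)} eq f → trans (cong (f x ℕ.+_) (eq f)) (x∙yz≈y∙xz +-commutativeSemigroup (f x) (f v) (sumOver f ys)))
  (sumOver-pick xs))

length-pick : ∀ (xs : List A) → All (λ (v , ys) → length xs ≡ suc (length ys)) (picks xs)
length-pick []       = []
length-pick (x ∷ xs) = refl ∷ All.map⁺ (All.map (cong suc) (length-pick xs))

-- Choosing a set and then a point of it is choosing a point and then the rest of the set.
combinations-picks : ∀ (φ : A → List A → ℕ) k xs →
  sumOver (λ S → sumOver (uncurry φ) (picks (toList S))) (combinations (suc k) xs)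
  ≡ sumOver (λ (v , ys) → sumOver (φ v ∘ toList) (combinations k ys)) (picks xs)
combinations-picks φ k []       = refl
combinations-picks φ k (x ∷ xs) = begin
  sumOver Φ (map (x ∷_) Ts ++ combinations (suc k) xs)
    ≡⟨ sumOver-++ Φ (map (x ∷_) Ts) _ ⟩
  sumOver Φ (map (x ∷_) Ts) + sumOver Φ (combinations (suc k) xs)
    ≡⟨ cong₂ _+_ (trans (sumOver-map Φ (x ∷_) Ts) (trans
         (sumOver-cong (λ T → cong (φ x (toList T) ℕ.+_) (sumOver-map (uncurry φ) (map₂ (x ∷_)) (picks (toList T)))) Ts)
         (sumOver-+ (φ x ∘ toList) _ Ts)))
         (combinations-picks φ k xs) ⟩
  sumOver (φ x ∘ toList) Ts + Θ k + sumOver (Ψ k) (picks xs)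
    ≡⟨ +-assoc (sumOver (φ x ∘ toList) Ts) _ _ ⟩
  sumOver (φ x ∘ toList) Ts + (Θ k + sumOver (Ψ k) (picks xs))
    ≡⟨ cong (sumOver (φ x ∘ toList) Ts ℕ.+_) (rest k) ⟩
  sumOver (φ x ∘ toList) Ts + sumOver (λ (v , ys) → sumOver (φ v ∘ toList) (combinations k (x ∷ ys))) (picks xs)
    ≡⟨ cong (sumOver (φ x ∘ toList) Ts ℕ.+_) (sumOver-map (Ψ k) (map₂ (x ∷_)) (picks xs)) ⟨
  sumOver (Ψ k) (picks (x ∷ xs)) ∎
  where
  open ≡-Reasoning
  Ts = combinations k xs
  Φ : ∀ {j} → Vec _ j → ℕ
  Φ S = sumOver (uncurry φ) (picks (toList S))
  Ψ : ∀ k → _ × List _ → ℕ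
  Ψ k (v , ys) = sumOver (φ v ∘ toList) (combinations k ys)
  Θ : ℕ → ℕ
  Θ k = sumOver (λ T → sumOver (λ (v , T′) → φ v (x ∷ T′)) (picks (toList T))) (combinations k xs)
  -- `Θ` collects the pairs in which `x` lies in the set but is not the chosen point. The induction
  -- hypothesis covers them one size lower, with `x` adjoined to what `φ` sees.
  rest : ∀ k → Θ k + sumOver (Ψ k) (picks xs)
         ≡ sumOver (λ (v , ys) → sumOver (φ v ∘ toList) (combinations k (x ∷ ys))) (picks xs)
  rest zero    = refl
  rest (suc k) = trans (cong (_+ sumOver (Ψ (suc k)) (picks xs)) (combinations-picks (λ v T → φ v (x ∷ T)) k xs))
    (trans (sym (sumOver-+ (λ (v , ys) → sumOver (λ T → φ v (x ∷ toList T)) (combinations k ys)) (Ψ (suc k)) (picks xs)))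
      (sumOver-cong (λ (v , ys) → trans
        (cong (_+ sumOver (φ v ∘ toList) (combinations (suc k) ys))
          (sym (sumOver-map (φ v ∘ toList) (x ∷_) (combinations k ys))))
        (sym (sumOver-++ (φ v ∘ toList) (map (x ∷_) (combinations k ys)) _))) (picks xs)))

-- The number of k-sets between a given j-set and an N-set.
extensions : (N k j : ℕ) → ℕ
extensions N       k       zero    = N C k
extensions (suc N) (suc k) (suc j) = extensions N k j
extensions _       _       (suc j) = 0

-- The larger set either contains the new point or not. The hypothesis `j ≤ N` lets the new point
-- lie outside the given j-set.
extensions-Pascal : ∀ N k j → j ≤ N → extensions (suc N) (suc k) j ≡ extensions N k j + extensions N (suc k) j
extensions-Pascal N       k       zero    j≤N       = sym (nCk+nC[k+1]≡[n+1]C[k+1] N k)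
extensions-Pascal (suc N) zero    (suc zero)    (s≤s j≤N) = refl
extensions-Pascal (suc N) zero    (suc (suc j)) (s≤s j≤N) with N
... | zero  = refl
... | suc _ = refl
extensions-Pascal (suc N) (suc k) (suc j) (s≤s j≤N) = extensions-Pascal N k j j≤N

extensions-pos : ∀ {N k j} → j ≤ k → k ≤ N → 0 < extensions N k j
extensions-pos {N}     {k}     {zero}  j≤k       k≤N       = C-pos N k k≤N
  where
  C-pos : ∀ N k → k ≤ N → 0 < N C k
  C-pos N       zero    k≤N       = s≤s z≤n
  C-pos (suc N) (suc k) (s≤s k≤N) = <-≤-trans (C-pos N k k≤N)
    (≤-trans (m≤m+n (N C k) (N C suc k)) (≤-reflexive (nCk+nC[k+1]≡[n+1]C[k+1] N k)))
extensions-pos {suc N} {suc k} {suc j} (s≤s j≤k) (s≤s k≤N) = extensions-pos j≤k k≤N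

count≤length : ∀ (p : A → Bool) xs → count p xs ≤ length xs
count≤length p []       = z≤n
count≤length p (x ∷ xs) with p x
... | true  = s≤s (count≤length p xs)
... | false = m≤n⇒m≤1+n (count≤length p xs)

-- Both sides count the pairs of a j-set of points satisfying `p` and a k-set containing it.
sumOver-combinations-C : ∀ (p : A → Bool) k j xs →
  sumOver (λ S → count p (toList S) C j) (combinations k xs) ≡ (count p xs C j) * extensions (length xs) k j
sumOver-combinations-C p zero zero xs = refl
sumOver-combinations-C p zero (suc j) [] = refl
sumOver-combinations-C p zero (suc j) (x ∷ xs) = sym (*-zeroʳ (count p (x ∷ xs) C suc j))
sumOver-combinations-C p (suc k) zero [] = refl
sumOver-combinations-C p (suc k) (suc j) [] = refl
sumOver-combinations-C p (suc k) j (x ∷ xs) = begin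
  sumOver f (map (x ∷_) Ts ++ combinations (suc k) xs)
    ≡⟨ sumOver-++ f (map (x ∷_) Ts) _ ⟩
  sumOver f (map (x ∷_) Ts) + sumOver f (combinations (suc k) xs)
    ≡⟨ cong₂ _+_ (sumOver-map f (x ∷_) Ts) (sumOver-combinations-C p (suc k) j xs) ⟩
  sumOver (λ T → (χ (p x) + count p (toList T)) C j) Ts + (c C j) * E (suc k) j
    ≡⟨ step (p x) j ⟩
  ((χ (p x) + c) C j) * extensions (suc N) (suc k) j ∎
  where
  open ≡-Reasoning
  Ts = combinations k xs
  c = count p xs
  N = length xs
  E = extensions N
  f : ∀ {i} → Vec _ i → ℕ
  f S = count p (toList S) C j

  Pascal : ∀ j → (c C j) * E k j + (c C j) * E (suc k) j ≡ (c C j) * extensions (suc N) (suc k) j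
  Pascal j with j ≤? N
  ... | yes j≤N = trans (sym (*-distribˡ-+ (c C j) _ _)) (cong ((c C j) *_) (sym (extensions-Pascal N k j j≤N)))
  -- Here `xs` has fewer than `j` points, so the binomial coefficient vanishes on both sides.
  ... | no  j≰N rewrite k>n⇒nCk≡0 {c} {j} (≤-<-trans (count≤length p xs) (≰⇒> j≰N)) = refl

  step : ∀ b j → sumOver (λ T → (χ b + count p (toList T)) C j) Ts + (c C j) * E (suc k) j
         ≡ ((χ b + c) C j) * extensions (suc N) (suc k) j
  step false j = trans (cong (_+ (c C j) * E (suc k) j) (sumOver-combinations-C p k j xs)) (Pascal j)
  step true zero = trans (cong (_+ (c C 0) * E (suc k) 0) (sumOver-combinations-C p k 0 xs)) (Pascal 0)
  step true (suc j) = begin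
    sumOver (λ T → suc (count p (toList T)) C suc j) Ts + (c C suc j) * E (suc k) (suc j)
      ≡⟨ cong (_+ (c C suc j) * E (suc k) (suc j)) (trans
           (sumOver-cong (λ T → sym (nCk+nC[k+1]≡[n+1]C[k+1] (count p (toList T)) j)) Ts)
           (trans (sumOver-+ (λ T → count p (toList T) C j) (λ T → count p (toList T) C suc j) Ts)
             (cong₂ _+_ (sumOver-combinations-C p k j xs) (sumOver-combinations-C p k (suc j) xs)))) ⟩
    ((c C j) * E k j + (c C suc j) * E k (suc j)) + (c C suc j) * E (suc k) (suc j)
      ≡⟨ trans (+-assoc ((c C j) * E k j) _ _) (cong ((c C j) * E k j ℕ.+_) (Pascal (suc j))) ⟩
    (c C j) * E k j + (c C suc j) * E k j
      ≡⟨ *-distribʳ-+ (E k j) (c C j) (c C suc j) ⟨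
    ((c C j) + (c C suc j)) * E k j
      ≡⟨ cong (_* E k j) (nCk+nC[k+1]≡[n+1]C[k+1] c j) ⟩
    (suc c C suc j) * E k j ∎

-- The deck determines the binomial moments of the degrees

sumOver-↭ : ∀ {R : A → A → Set} (f : A → ℕ) → (∀ {x y} → R x y → f x ≡ f y) →
  ∀ {xs ys} → Homogeneous.Permutation R xs ys → sumOver f xs ≡ sumOver f ys
sumOver-↭ {R = R} f f-resp = go
  where
  pointwise : ∀ {xs ys} → Pointwise R xs ys → sumOver f xs ≡ sumOver f ys
  pointwise []       = refl
  pointwise (r ∷ rs) = cong₂ _+_ (f-resp r) (pointwise rs)

  go : ∀ {xs ys} → Homogeneous.Permutation R xs ys → sumOver f xs ≡ sumOver f ys
  go (Homogeneous.refl rs)      = pointwise rs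
  go (Homogeneous.prep r p)     = cong₂ _+_ (f-resp r) (go p)
  go (Homogeneous.swap {x = x} {y} r s p) =
    trans (x∙yz≈y∙xz +-commutativeSemigroup (f x) (f y) _) (cong₂ _+_ (f-resp s) (cong₂ _+_ (f-resp r) (go p)))
  go (Homogeneous.trans p q)    = trans (go p) (go q)

binomialMoment : ∀ {n} → ℕ → Graph n → ℕ
binomialMoment j G = sumOver (_C j) (degreeList G)

binomialMoment-∑ : ∀ {n} j (G : Graph n) → binomialMoment j G ≡ ∑.sum (λ v → degree G v C j)
binomialMoment-∑ {n} j G = trans (sumOver-map (_C j) (degree G) (allFin n)) (sumOver-allFin (λ v → degree G v C j))

binomialMoment-≅ : ∀ {n} j {G H : Graph n} → G ≅ H → binomialMoment j G ≡ binomialMoment j H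
binomialMoment-≅ j {G} {H} e = trans (binomialMoment-∑ j G) (trans
  (trans (∑.sum-cong-≗ (λ v → cong (_C j) (degree-≅ e v))) (sym (∑.sum-permute (λ v → degree H v C j) (bij e))))
  (sym (binomialMoment-∑ j H)))

-- A vertex is not its own neighbour, so removing it from the list leaves its count unchanged. This
-- gives the form to which `combinations-picks` applies.
sumOver-picks-irreflexive : ∀ (a : A → A → Bool) → (∀ v → a v v ≡ false) → ∀ (g : ℕ → ℕ) xs →
  sumOver (λ v → g (count (a v) xs)) xs ≡ sumOver (λ (v , ys) → g (count (a v) ys)) (picks xs)
sumOver-picks-irreflexive a irr g xs = trans
  (sym (sumOver-picks-proj₁ (λ v → g (count (a v) xs)) xs))
  (sumOver-cong-local (All.map
    (λ {(v , ys)} eq → cong g (trans (eq (χ ∘ a v)) (cong (λ b → χ b + count (a v) ys) (irr v)))) (sumOver-pick xs)))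

binomialMoment-induced : ∀ {n k} j (G : Graph n) (S : Vec (Fin n) k) → binomialMoment j (induced G S) ≡
  sumOver (λ v → count (adj G v) (toList S) C j) (toList S)
binomialMoment-induced j G S = trans (binomialMoment-∑ j (induced G S)) (trans
  (∑.sum-cong-≗ (λ i → cong (_C j) (trans (degree-∑ (induced G S) i) (sym (sumOver-toList (χ ∘ adj G (lookup S i)) S)))))
  (sym (sumOver-toList (λ v → count (adj G v) (toList S) C j) S)))

-- Choose the vertex `v` first and the other `k` vertices of the card afterwards. Each j-set of
-- neighbours of `v` then lies in `extensions n k j` of the choices.
deck-binomialMoment : ∀ {n} k j (G : Graph (suc n)) →
  sumOver (binomialMoment j) (deck (suc k) G) ≡ binomialMoment j G * extensions n k j
deck-binomialMoment {n} k j G = begin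
  sumOver (binomialMoment j) (deck (suc k) G)
    ≡⟨ sumOver-map (binomialMoment j) (induced G) (kSubsets (suc k) (suc n)) ⟩
  sumOver (binomialMoment j ∘ induced G) (kSubsets (suc k) (suc n))
    ≡⟨ sumOver-cong (λ S → trans (binomialMoment-induced j G S)
         (sumOver-picks-irreflexive (adj G) (adj-irrefl G) (_C j) (toList S))) (kSubsets (suc k) (suc n)) ⟩
  sumOver (λ S → sumOver (λ (v , ys) → count (adj G v) ys C j) (picks (toList S))) (kSubsets (suc k) (suc n))
    ≡⟨ combinations-picks (λ v ys → count (adj G v) ys C j) k vs ⟩
  sumOver (λ (v , ys) → sumOver (λ T → count (adj G v) (toList T) C j) (combinations k ys)) (picks vs)
    ≡⟨ sumOver-cong (λ (v , ys) → sumOver-combinations-C (adj G v) k j ys) (picks vs) ⟩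
  sumOver (λ (v , ys) → (count (adj G v) ys C j) * extensions (length ys) k j) (picks vs)
    ≡⟨ sumOver-cong-local (All.map (λ {(v , ys)} eq → cong (λ l → (count (adj G v) ys C j) * extensions l k j)
         (suc-injective (trans (sym eq) (length-tabulate {n = suc n} (λ i → i))))) (length-pick vs)) ⟩
  sumOver (λ (v , ys) → (count (adj G v) ys C j) * extensions n k j) (picks vs)
    ≡⟨ sumOver-*ʳ (λ (v , ys) → count (adj G v) ys C j) (extensions n k j) (picks vs) ⟩
  sumOver (λ (v , ys) → count (adj G v) ys C j) (picks vs) * extensions n k j
    ≡⟨ cong (_* extensions n k j) (trans (sym (sumOver-picks-irreflexive (adj G) (adj-irrefl G) (_C j) vs))
         (trans (sumOver-cong (λ v → cong (_C j) (trans (sumOver-allFin (χ ∘ adj G v)) (sym (degree-∑ G v)))) vs)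
           (sym (sumOver-map (_C j) (degree G) vs)))) ⟩
  binomialMoment j G * extensions n k j ∎
  where
  open ≡-Reasoning
  vs = allFin (suc n)

SameDeck⇒binomialMoment : ∀ {n} k j (G H : Graph (suc n)) → j ≤ k → k ≤ n → SameDeck (suc k) G H →
  binomialMoment j G ≡ binomialMoment j H
SameDeck⇒binomialMoment {n} k j G H j≤k k≤n same =
  *-cancelʳ-≡ _ _ (extensions n k j) {{>-nonZero (extensions-pos j≤k k≤n)}} (begin
    binomialMoment j G * extensions n k j       ≡⟨ deck-binomialMoment k j G ⟨
    sumOver (binomialMoment j) (deck (suc k) G) ≡⟨ sumOver-↭ (binomialMoment j) (binomialMoment-≅ j) same ⟩
    sumOver (binomialMoment j) (deck (suc k) H) ≡⟨ deck-binomialMoment k j H ⟩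
    binomialMoment j H * extensions n k j       ∎)
  where open ≡-Reasoning

-- Newton interpolation

multiplicity : ℕ → List ℕ → ℕ
multiplicity x = count (_≡ᵇ x)

≡ᵇ-refl : ∀ x → (x ≡ᵇ x) ≡ true
≡ᵇ-refl zero    = refl
≡ᵇ-refl (suc x) = ≡ᵇ-refl x

sumOver-↭-≡ : ∀ {A : Set} (f : A → ℕ) {xs ys} → xs ↭ ys → sumOver f xs ≡ sumOver f ys
sumOver-↭-≡ f p = sumOver-↭ f (cong f) (↭⇒↭ₛ p)

multiplicity-∈ : ∀ {x} ds → 0 < multiplicity x ds → x ∈ ds
multiplicity-∈ {x} (d ∷ ds) pos with d ≡ᵇ x in eq
... | true  = here (sym (≡ᵇ⇒≡ d x (subst Bool.T (sym eq) tt)))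
... | false = there (multiplicity-∈ ds pos)

extract : ∀ k x ds → k ≤ multiplicity x ds → ∃ λ ds′ → ds ↭ replicate k x ++ ds′
extract zero    x ds k≤ = ds , ↭.refl
extract (suc k) x ds k≤ with ∈-∃++ (multiplicity-∈ ds (≤-trans (s≤s z≤n) k≤))
... | as , bs , refl = let ds′ , p = extract k x (as ++ bs) (s≤s⁻¹ (≤-trans k≤ (≤-reflexive eq)))
                       in ds′ , ↭-trans (shift x as bs) (↭-prep x p)
  where
  eq : multiplicity x (as ++ x ∷ bs) ≡ suc (multiplicity x (as ++ bs))
  eq = trans (sumOver-↭-≡ (χ ∘ (_≡ᵇ x)) (shift x as bs)) (cong (λ b → χ b + multiplicity x (as ++ bs)) (≡ᵇ-refl x))

multiplicity⇒↭ : ∀ ds es → (∀ x → multiplicity x ds ≡ multiplicity x es) → ds ↭ es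
multiplicity⇒↭ []       []       eq = ↭.refl
multiplicity⇒↭ []       (e ∷ es) eq = contradiction (trans (eq e) (cong (λ b → χ b + multiplicity e es) (≡ᵇ-refl e))) λ ()
multiplicity⇒↭ (d ∷ ds) es       eq
  with extract 1 d es (≤-trans (s≤s z≤n)
         (≤-reflexive (trans (cong (λ b → χ b + multiplicity d ds) (sym (≡ᵇ-refl d))) (eq d))))
... | es′ , p = ↭-trans (↭-prep d (multiplicity⇒↭ ds es′ λ x →
  +-cancelˡ-≡ (χ (d ≡ᵇ x)) _ _ (trans (eq x) (sumOver-↭-≡ (χ ∘ (_≡ᵇ x)) p)))) (↭-sym p)

Δ : (ℕ → ℤ) → ℕ → ℤ
Δ F d = F (suc d) ℤ.- F d

-- The j-th iterated difference at 0, which is the coefficient of `d C j` in Newton's formula.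
Δ₀ : ℕ → (ℕ → ℤ) → ℤ
Δ₀ zero    F = F 0
Δ₀ (suc j) F = Δ₀ j (Δ F)

Δ₀-cong : ∀ j {F G} → F ≗ G → Δ₀ j F ≡ Δ₀ j G
Δ₀-cong zero    F≗G = F≗G 0
Δ₀-cong (suc j) F≗G = Δ₀-cong j (λ d → cong₂ ℤ._-_ (F≗G (suc d)) (F≗G d))

rangeSum : ℕ → (ℕ → ℤ) → ℤ
rangeSum N f = ∑ℤ.sum {N} (f ∘ toℕ)

-- Induction on `d`: write F (d + 1) as F d + Δ F d, expand both, and combine the coefficients by
-- Pascal's rule.
newton : ∀ d N F → d < N → F d ≡ rangeSum N (λ j → + (d C j) ℤ.* Δ₀ j F)
newton zero (suc N) F d<N = sym (begin
  1ℤ ℤ.* F 0 ℤ.+ rangeSum N (λ j → 0ℤ ℤ.* Δ₀ (suc j) F)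
    ≡⟨ cong₂ ℤ._+_ (sym (ℤ.*-identityˡ (F 0))) (∑ℤ.*-distribˡ-sum {N} 0ℤ (λ i → Δ₀ (suc (toℕ i)) F)) ⟨
  F 0 ℤ.+ 0ℤ ℤ.* ∑ℤ.sum {N} (λ i → Δ₀ (suc (toℕ i)) F)
    ≡⟨ ℤ.+-identityʳ (F 0) ⟩
  F 0 ∎)
  where open ≡-Reasoning
newton (suc d) (suc N) F (s≤s d<N) = begin
  F (suc d)
    ≡⟨ telescope (F (suc d)) (F d) ⟩
  F d ℤ.+ Δ F d
    ≡⟨ cong₂ ℤ._+_ (newton d (suc N) F (m≤n⇒m≤1+n d<N)) (newton d N (Δ F) d<N) ⟩
  (+ (d C 0) ℤ.* F 0 ℤ.+ rangeSum N (λ j → + (d C suc j) ℤ.* Δ₀ (suc j) F)) ℤ.+ rangeSum N (λ j → + (d C j) ℤ.* Δ₀ (suc j) F)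
    ≡⟨ ℤ.+-assoc (+ (d C 0) ℤ.* F 0) _ _ ⟩
  + (d C 0) ℤ.* F 0 ℤ.+ (rangeSum N (λ j → + (d C suc j) ℤ.* Δ₀ (suc j) F) ℤ.+ rangeSum N (λ j → + (d C j) ℤ.* Δ₀ (suc j) F))
    ≡⟨ cong (λ s → + (d C 0) ℤ.* F 0 ℤ.+ s) (trans (sym (∑ℤ.∑-distrib-+ {N} _ _)) (∑ℤ.sum-cong-≗ {N} λ i → Pascal (toℕ i))) ⟩
  + (suc d C 0) ℤ.* F 0 ℤ.+ rangeSum N (λ j → + (suc d C suc j) ℤ.* Δ₀ (suc j) F) ∎
  where
  open ≡-Reasoning
  telescope : ∀ x y → x ≡ y ℤ.+ (x ℤ.- y)
  telescope = ℤ-Solver.solve-∀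
  Pascal : ∀ j → + (d C suc j) ℤ.* Δ₀ (suc j) F ℤ.+ + (d C j) ℤ.* Δ₀ (suc j) F ≡ + (suc d C suc j) ℤ.* Δ₀ (suc j) F
  Pascal j = trans (sym (ℤ.*-distribʳ-+ (Δ₀ (suc j) F) (+ (d C suc j)) (+ (d C j))))
    (cong (λ c → + c ℤ.* Δ₀ (suc j) F) (trans (+-comm (d C suc j) (d C j)) (nCk+nC[k+1]≡[n+1]C[k+1] d j)))

total : (ℕ → ℤ) → List ℕ → ℤ
total F []       = 0ℤ
total F (d ∷ ds) = F d ℤ.+ total F ds

total-pos : ∀ (f : ℕ → ℕ) ds → total (+_ ∘ f) ds ≡ + sumOver f ds
total-pos f []       = refl
total-pos f (d ∷ ds) = cong (λ s → + f d ℤ.+ s) (total-pos f ds)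

∣total∣≤ : ∀ F W {N} ds → All (_< N) ds → (∀ {d} → d < N → ∣ F d ∣ ≤ W) → ∣ total F ds ∣ ≤ length ds * W
∣total∣≤ F W []       []           bound = z≤n
∣total∣≤ F W (d ∷ ds) (d<N ∷ ds<N) bound =
  ≤-trans (ℤ.∣i+j∣≤∣i∣+∣j∣ (F d) (total F ds)) (+-mono-≤ (bound d<N) (∣total∣≤ F W ds ds<N bound))

-- By linearity a sum over the list depends only on the binomial moments of the list.
newton-total : ∀ N F ds → All (_< N) ds → total F ds ≡ rangeSum N (λ j → + sumOver (_C j) ds ℤ.* Δ₀ j F)
newton-total N F []       []           = ∑ℤ.*-distribˡ-sum {N} 0ℤ (λ i → Δ₀ (toℕ i) F)
newton-total N F (d ∷ ds) (d<N ∷ ds<N) = trans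
  (cong₂ ℤ._+_ (newton d N F d<N) (newton-total N F ds ds<N))
  (trans (sym (∑ℤ.∑-distrib-+ {N} _ _))
    (∑ℤ.sum-cong-≗ {N} λ i → sym (ℤ.*-distribʳ-+ (Δ₀ (toℕ i) F) (+ (d C toℕ i)) (+ sumOver (_C toℕ i) ds))))

rangeSum-last3 : ∀ m (f : ℕ → ℤ) → (∀ {j} → j < m → f j ≡ 0ℤ) → rangeSum (3 + m) f ≡ f m ℤ.+ f (1 + m) ℤ.+ f (2 + m)
rangeSum-last3 zero    f f≡0 = last3 (f 0) (f 1) (f 2)
  where
  last3 : ∀ a b c → a ℤ.+ (b ℤ.+ (c ℤ.+ 0ℤ)) ≡ a ℤ.+ b ℤ.+ c
  last3 = ℤ-Solver.solve-∀
rangeSum-last3 (suc m) f f≡0 = trans (cong₂ ℤ._+_ (f≡0 (s≤s z≤n)) (rangeSum-last3 m (f ∘ suc) (f≡0 ∘ s≤s)))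
  (ℤ.+-identityˡ _)

-- Alternating test functions

alternating : ℕ → ℤ
alternating zero    = 1ℤ
alternating (suc d) = ℤ.- alternating d

∣alternating*∣ : ∀ d x → ∣ alternating d ℤ.* x ∣ ≡ ∣ x ∣
∣alternating*∣ d x = trans (ℤ.abs-* (alternating d) x) (trans (cong (_* ∣ x ∣) (∣alt∣ d)) (*-identityˡ ∣ x ∣))
  where
  ∣alt∣ : ∀ d → ∣ alternating d ∣ ≡ 1
  ∣alt∣ zero    = refl
  ∣alt∣ (suc d) = trans (ℤ.∣-i∣≡∣i∣ (alternating d)) (∣alt∣ d)

-- The basis 1, 2d, 4d(d - 1) is scaled so that the family is closed under `Δ` and the m-th
-- difference at 0 becomes (-2)^m (u + v m + w m (m - 1)).
alternatingQuadratic : (u v w : ℤ) → ℕ → ℤ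
alternatingQuadratic u v w d =
  alternating d ℤ.* (u ℤ.+ v ℤ.* (+ 2 ℤ.* + d) ℤ.+ w ℤ.* (+ 4 ℤ.* (+ d ℤ.* (+ d ℤ.- 1ℤ))))

Δ-alternatingQuadratic : ∀ u v w → Δ (alternatingQuadratic u v w) ≗
  alternatingQuadratic (-[1+ 1 ] ℤ.* (u ℤ.+ v)) (-[1+ 1 ] ℤ.* (v ℤ.+ + 2 ℤ.* w)) (-[1+ 1 ] ℤ.* w)
Δ-alternatingQuadratic u v w d = identity (alternating d) u v w (+ d)
  where
  identity : ∀ e u v w x →
    (ℤ.- e) ℤ.* (u ℤ.+ v ℤ.* (+ 2 ℤ.* (1ℤ ℤ.+ x)) ℤ.+ w ℤ.* (+ 4 ℤ.* ((1ℤ ℤ.+ x) ℤ.* ((1ℤ ℤ.+ x) ℤ.- 1ℤ))))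
      ℤ.- e ℤ.* (u ℤ.+ v ℤ.* (+ 2 ℤ.* x) ℤ.+ w ℤ.* (+ 4 ℤ.* (x ℤ.* (x ℤ.- 1ℤ))))
    ≡ e ℤ.* (-[1+ 1 ] ℤ.* (u ℤ.+ v) ℤ.+ (-[1+ 1 ] ℤ.* (v ℤ.+ + 2 ℤ.* w)) ℤ.* (+ 2 ℤ.* x)
      ℤ.+ (-[1+ 1 ] ℤ.* w) ℤ.* (+ 4 ℤ.* (x ℤ.* (x ℤ.- 1ℤ))))
  identity = ℤ-Solver.solve-∀

Δ₀-alternatingQuadratic : ∀ m u v w → Δ₀ m (alternatingQuadratic u v w) ≡
  -[1+ 1 ] ℤ.^ m ℤ.* (u ℤ.+ v ℤ.* + m ℤ.+ w ℤ.* (+ m ℤ.* (+ m ℤ.- 1ℤ)))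
Δ₀-alternatingQuadratic zero u v w = identity u v w
  where
  identity : ∀ u v w → 1ℤ ℤ.* (u ℤ.+ v ℤ.* (+ 2 ℤ.* 0ℤ) ℤ.+ w ℤ.* (+ 4 ℤ.* (0ℤ ℤ.* (0ℤ ℤ.- 1ℤ))))
    ≡ 1ℤ ℤ.* (u ℤ.+ v ℤ.* 0ℤ ℤ.+ w ℤ.* (0ℤ ℤ.* (0ℤ ℤ.- 1ℤ)))
  identity = ℤ-Solver.solve-∀
Δ₀-alternatingQuadratic (suc m) u v w = trans (Δ₀-cong m (Δ-alternatingQuadratic u v w))
  (trans (Δ₀-alternatingQuadratic m (-[1+ 1 ] ℤ.* (u ℤ.+ v)) (-[1+ 1 ] ℤ.* (v ℤ.+ + 2 ℤ.* w)) (-[1+ 1 ] ℤ.* w))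
    (identity (-[1+ 1 ] ℤ.^ m) u v w (+ m)))
  where
  identity : ∀ p u v w x →
    p ℤ.* (-[1+ 1 ] ℤ.* (u ℤ.+ v) ℤ.+ (-[1+ 1 ] ℤ.* (v ℤ.+ + 2 ℤ.* w)) ℤ.* x ℤ.+ (-[1+ 1 ] ℤ.* w) ℤ.* (x ℤ.* (x ℤ.- 1ℤ)))
    ≡ (-[1+ 1 ] ℤ.* p) ℤ.* (u ℤ.+ v ℤ.* (1ℤ ℤ.+ x) ℤ.+ w ℤ.* ((1ℤ ℤ.+ x) ℤ.* ((1ℤ ℤ.+ x) ℤ.- 1ℤ)))
  identity = ℤ-Solver.solve-∀

-- Lists with equal binomial moments

-- This is 2n < 2^(n - 3) for n = 7 + m. In the induction step the added term is the excess of twice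
-- the old left side over the new one; the next two bounds are proved in the same way.
2*[7+m]<2^[4+m] : ∀ m → (7 + m) + (7 + m) < 2 ^ (4 + m)
2*[7+m]<2^[4+m] zero    = m≤m+n 15 1
2*[7+m]<2^[4+m] (suc m) = begin-strict
  (8 + m) + (8 + m)               ≤⟨ m≤m+n _ (12 + 2 * m) ⟩
  (8 + m) + (8 + m) + (12 + 2 * m) ≡⟨ identity m ⟩
  2 * ((7 + m) + (7 + m))         <⟨ *-monoʳ-< 2 (2*[7+m]<2^[4+m] m) ⟩
  2 ^ (5 + m)                     ∎
  where
  open ≤-Reasoning
  identity : ∀ m → (8 + m) + (8 + m) + (12 + 2 * m) ≡ 2 * ((7 + m) + (7 + m))
  identity = solve-∀

-- Here n = 10 + m. At n = 9 both this bound and `quadratic-bound` fail, with 144 against 128 and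
-- 1152 against 1024.
linear-bound : ∀ m → ((10 + m) + (10 + m)) * (9 + m) < 2 ^ (7 + m) * 2
linear-bound zero    = m≤m+n 181 75
linear-bound (suc m) = begin-strict
  ((11 + m) + (11 + m)) * (10 + m)                            ≤⟨ m≤m+n _ (140 + 34 * m + 2 * (m * m)) ⟩
  ((11 + m) + (11 + m)) * (10 + m) + (140 + 34 * m + 2 * (m * m)) ≡⟨ identity m ⟩
  2 * (((10 + m) + (10 + m)) * (9 + m))                       <⟨ *-monoʳ-< 2 (linear-bound m) ⟩
  2 * (2 ^ (7 + m) * 2)                                       ≡⟨ *-assoc 2 (2 ^ (7 + m)) 2 ⟨
  2 ^ (8 + m) * 2                                             ∎
  where
  open ≤-Reasoning
  identity : ∀ m → ((11 + m) + (11 + m)) * (10 + m) + (140 + 34 * m + 2 * (m * m)) ≡ 2 * (((10 + m) + (10 + m)) * (9 + m))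
  identity = solve-∀

quadratic-bound : ∀ m → ((10 + m) + (10 + m)) * ((9 + m) * (9 + m)) < 2 ^ (7 + m) * 16
quadratic-bound zero    = m≤m+n 1621 427
quadratic-bound (suc m) = begin-strict
  ((11 + m) + (11 + m)) * ((10 + m) * (10 + m))                            ≤⟨ m≤m+n _ r ⟩
  ((11 + m) + (11 + m)) * ((10 + m) * (10 + m)) + r                        ≡⟨ identity m ⟩
  2 * (((10 + m) + (10 + m)) * ((9 + m) * (9 + m)))                       <⟨ *-monoʳ-< 2 (quadratic-bound m) ⟩
  2 * (2 ^ (7 + m) * 16)                                       ≡⟨ *-assoc 2 (2 ^ (7 + m)) 16 ⟨
  2 ^ (8 + m) * 16                                             ∎
  where
  open ≤-Reasoning
  r = 1040 + 404 * m + 50 * (m * m) + 2 * (m * (m * m))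
  identity : ∀ m → ((11 + m) + (11 + m)) * ((10 + m) * (10 + m)) + (1040 + 404 * m + 50 * (m * m) + 2 * (m * (m * m)))
    ≡ 2 * (((10 + m) + (10 + m)) * ((9 + m) * (9 + m)))
  identity = solve-∀

∣-2^m∣ : ∀ m → ∣ -[1+ 1 ] ℤ.^ m ∣ ≡ 2 ^ m
∣-2^m∣ zero    = refl
∣-2^m∣ (suc m) = trans (ℤ.abs-* -[1+ 1 ] (-[1+ 1 ] ℤ.^ m)) (cong (2 *_) (∣-2^m∣ m))

-- With e = d + t the triangle inequality gives 4de + (e - d)² = (d + e)².
∣4d[d+t]-t²∣≤ : ∀ d t → ∣ + (4 * (d * (d + t))) ℤ.- + (t * t) ∣ ≤ (d + (d + t)) * (d + (d + t))
∣4d[d+t]-t²∣≤ d t = ≤-trans (ℤ.∣i-j∣≤∣i∣+∣j∣ (+ (4 * (d * (d + t)))) (+ (t * t))) (≤-reflexive (identity d t))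
  where
  identity : ∀ d t → 4 * (d * (d + t)) + t * t ≡ (d + (d + t)) * (d + (d + t))
  identity = solve-∀

-- The value is d - e, where e = c - d.
∣linear∣≤ : ∀ c {d} → d ≤ c → ∣ (ℤ.- + c) ℤ.+ 1ℤ ℤ.* (+ 2 ℤ.* + d) ℤ.+ 0ℤ ℤ.* (+ 4 ℤ.* (+ d ℤ.* (+ d ℤ.- 1ℤ))) ∣ ≤ c
∣linear∣≤ c {d} d≤c with e , refl ← m≤n⇒∃[o]m+o≡n d≤c =
  ≤-trans (≤-reflexive (cong ∣_∣ (identity (+ d) (+ e)))) (ℤ.∣i-j∣≤∣i∣+∣j∣ (+ d) (+ e))
  where
  identity : ∀ x y → (ℤ.- (x ℤ.+ y)) ℤ.+ 1ℤ ℤ.* (+ 2 ℤ.* x) ℤ.+ 0ℤ ℤ.* (+ 4 ℤ.* (x ℤ.* (x ℤ.- 1ℤ))) ≡ x ℤ.- y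
  identity = ℤ-Solver.solve-∀

-- The value is 8de − (d + e)², where e = c − d.
∣quadratic∣≤ : ∀ c {d} → d ≤ c →
  ∣ (ℤ.- (+ c ℤ.* + c)) ℤ.+ (+ 4 ℤ.* (+ c ℤ.- 1ℤ)) ℤ.* (+ 2 ℤ.* + d)
    ℤ.+ -[1+ 1 ] ℤ.* (+ 4 ℤ.* (+ d ℤ.* (+ d ℤ.- 1ℤ))) ∣ ≤ c * c
∣quadratic∣≤ c {d} d≤c with e , refl ← m≤n⇒∃[o]m+o≡n d≤c with ≤-total d e
... | inj₁ d≤e with t , refl ← m≤n⇒∃[o]m+o≡n d≤e =
  ≤-trans (≤-reflexive (cong ∣_∣ (trans (identity (+ d) (+ t))
    (cong₂ ℤ._-_ (trans (cong (+ 4 ℤ.*_) (sym (ℤ.pos-* d (d + t)))) (sym (ℤ.pos-* 4 (d * (d + t))))) (sym (ℤ.pos-* t t))))))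
  (∣4d[d+t]-t²∣≤ d t)
  where
  identity : ∀ x t → let c = x ℤ.+ (x ℤ.+ t) in
    (ℤ.- (c ℤ.* c)) ℤ.+ (+ 4 ℤ.* (c ℤ.- 1ℤ)) ℤ.* (+ 2 ℤ.* x) ℤ.+ -[1+ 1 ] ℤ.* (+ 4 ℤ.* (x ℤ.* (x ℤ.- 1ℤ)))
    ≡ + 4 ℤ.* (x ℤ.* (x ℤ.+ t)) ℤ.- t ℤ.* t
  identity = ℤ-Solver.solve-∀
... | inj₂ e≤d with t , refl ← m≤n⇒∃[o]m+o≡n e≤d =
  ≤-trans (≤-reflexive (cong ∣_∣ (trans (identity (+ e) (+ t))
    (cong₂ ℤ._-_ (trans (cong (+ 4 ℤ.*_) (sym (ℤ.pos-* e (e + t)))) (sym (ℤ.pos-* 4 (e * (e + t))))) (sym (ℤ.pos-* t t))))))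
  (≤-trans (∣4d[d+t]-t²∣≤ e t) (≤-reflexive (cong₂ _*_ (+-comm e (e + t)) (+-comm e (e + t)))))
  where
  identity : ∀ y t → let x = y ℤ.+ t
                         c = x ℤ.+ y in
    (ℤ.- (c ℤ.* c)) ℤ.+ (+ 4 ℤ.* (c ℤ.- 1ℤ)) ℤ.* (+ 2 ℤ.* x) ℤ.+ -[1+ 1 ] ℤ.* (+ 4 ℤ.* (x ℤ.* (x ℤ.- 1ℤ)))
    ≡ + 4 ℤ.* (y ℤ.* (y ℤ.+ t)) ℤ.- t ℤ.* t
  identity = ℤ-Solver.solve-∀

k*∣i∣<k⇒i≡0 : ∀ k i → k * ∣ i ∣ < k → i ≡ 0ℤ
k*∣i∣<k⇒i≡0 k i lt with ∣ i ∣ in eq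
... | zero  = ℤ.∣i∣≡0⇒i≡0 eq
... | suc a = contradiction lt (≤⇒≯ (m≤m*n k (suc a)))

table : List ℤ → ℕ → ℤ
table []       d       = 0ℤ
table (x ∷ xs) zero    = x
table (x ∷ xs) (suc d) = table xs d

∣table∣≤ : ∀ {W xs} → All (λ x → ∣ x ∣ ≤ W) xs → ∀ d → ∣ table xs d ∣ ≤ W
∣table∣≤ []       d       = z≤n
∣table∣≤ (b ∷ bs) zero    = b
∣table∣≤ (b ∷ bs) (suc d) = ∣table∣≤ bs d

-- Two degree lists for n = m + 3, with the equalities of moments that the deck provides. For n ≥ 8
-- nothing more about the graphs is used.
record MomentPair (m : ℕ) : Set where
  field
    gs hs   : List ℕ
    ∣gs∣    : length gs ≡ 3 + m
    ∣hs∣    : length hs ≡ 3 + m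
    gs<     : All (_< 3 + m) gs
    hs<     : All (_< 3 + m) hs
    moments : ∀ {j} → j < m → sumOver (_C j) gs ≡ sumOver (_C j) hs

  -- The pairing Σ_d x_d F(d) of a test function with the differences x_d of the multiplicities.
  Λ : (ℕ → ℤ) → ℤ
  Λ F = total F gs ℤ.- total F hs

  μ : ℕ → ℤ
  μ j = + sumOver (_C j) gs ℤ.- + sumOver (_C j) hs

  -- c = (−1)^m γ and a − b + c = (−1)^m α, where Σ_d x_d t^d = (1 − t)^m (α + β t + γ t²).
  a b c : ℤ
  a = μ m
  b = μ (1 + m)
  c = μ (2 + m)

  -- Degrees are below m + 3, so Newton's formula has m + 3 terms, and the first m cancel because
  -- those moments agree.
  Λ-newton : ∀ F → Λ F ≡ a ℤ.* Δ₀ m F ℤ.+ b ℤ.* Δ₀ (1 + m) F ℤ.+ c ℤ.* Δ₀ (2 + m) F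
  Λ-newton F = trans (cong₂ ℤ._-_ (newton-total N F gs gs<) (newton-total N F hs hs<))
    (trans (difference N (λ j → + sumOver (_C j) gs) (λ j → + sumOver (_C j) hs) (λ j → Δ₀ j F))
    (rangeSum-last3 m (λ j → μ j ℤ.* Δ₀ j F) λ {j} j<m →
      cong (ℤ._* Δ₀ j F) (ℤ.i≡j⇒i-j≡0 (cong +_ (moments j<m)))))
    where
    N = 3 + m
    difference : ∀ N (f g h : ℕ → ℤ) → rangeSum N (λ j → f j ℤ.* h j) ℤ.- rangeSum N (λ j → g j ℤ.* h j)
      ≡ rangeSum N (λ j → (f j ℤ.- g j) ℤ.* h j)
    difference zero    f g h = refl
    difference (suc N) f g h = trans
      (identity (f 0) (g 0) (h 0) (rangeSum N (λ j → f (suc j) ℤ.* h (suc j))) (rangeSum N (λ j → g (suc j) ℤ.* h (suc j))))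
      (cong (λ s → (f 0 ℤ.- g 0) ℤ.* h 0 ℤ.+ s) (difference N (f ∘ suc) (g ∘ suc) (h ∘ suc)))
      where
      identity : ∀ f g h s t → (f ℤ.* h ℤ.+ s) ℤ.- (g ℤ.* h ℤ.+ t) ≡ (f ℤ.- g) ℤ.* h ℤ.+ (s ℤ.- t)
      identity = ℤ-Solver.solve-∀

  ∣Λ∣≤ : ∀ F W → (∀ {d} → d < 3 + m → ∣ F d ∣ ≤ W) → ∣ Λ F ∣ ≤ ((3 + m) + (3 + m)) * W
  ∣Λ∣≤ F W bound = begin
    ∣ Λ F ∣                             ≤⟨ ℤ.∣i-j∣≤∣i∣+∣j∣ (total F gs) (total F hs) ⟩
    ∣ total F gs ∣ + ∣ total F hs ∣     ≤⟨ +-mono-≤ (∣total∣≤ F W gs gs< bound) (∣total∣≤ F W hs hs< bound) ⟩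
    length gs * W + length hs * W       ≡⟨ cong₂ (λ x y → x * W + y * W) ∣gs∣ ∣hs∣ ⟩
    (3 + m) * W + (3 + m) * W           ≡⟨ *-distribʳ-+ W (3 + m) (3 + m) ⟨
    ((3 + m) + (3 + m)) * W             ∎
    where open ≤-Reasoning

  Λ-alternatingQuadratic : ∀ u v w → let p = λ x → u ℤ.+ v ℤ.* x ℤ.+ w ℤ.* (x ℤ.* (x ℤ.- 1ℤ)) in
    Λ (alternatingQuadratic u v w) ≡
    -[1+ 1 ] ℤ.^ m ℤ.* (a ℤ.* p (+ m) ℤ.- + 2 ℤ.* (b ℤ.* p (1ℤ ℤ.+ + m)) ℤ.+ + 4 ℤ.* (c ℤ.* p (+ 2 ℤ.+ + m)))
  Λ-alternatingQuadratic u v w = trans (Λ-newton (alternatingQuadratic u v w)) (trans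
    (cong₂ ℤ._+_ (cong₂ ℤ._+_ (cong (a ℤ.*_) (Δ₀-alternatingQuadratic m u v w))
      (cong (b ℤ.*_) (Δ₀-alternatingQuadratic (1 + m) u v w)))
      (cong (c ℤ.*_) (Δ₀-alternatingQuadratic (2 + m) u v w)))
    (identity (-[1+ 1 ] ℤ.^ m) a b c _ _ _))
    where
    identity : ∀ e a b c x y z →
      a ℤ.* (e ℤ.* x) ℤ.+ b ℤ.* ((-[1+ 1 ] ℤ.* e) ℤ.* y) ℤ.+ c ℤ.* ((-[1+ 1 ] ℤ.* (-[1+ 1 ] ℤ.* e)) ℤ.* z)
      ≡ e ℤ.* (a ℤ.* x ℤ.- + 2 ℤ.* (b ℤ.* y) ℤ.+ + 4 ℤ.* (c ℤ.* z))
    identity = ℤ-Solver.solve-∀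

  -- Testing against indicator functions of single values recovers all multiplicities.
  Λ≡0⇒↭ : (∀ F → Λ F ≡ 0ℤ) → gs ↭ hs
  Λ≡0⇒↭ Λ≡0 = multiplicity⇒↭ gs hs λ x → ℤ.+-injective (trans (sym (total-pos (χ ∘ (_≡ᵇ x)) gs))
    (trans (ℤ.i-j≡0⇒i≡j _ _ (Λ≡0 (+_ ∘ χ ∘ (_≡ᵇ x)))) (total-pos (χ ∘ (_≡ᵇ x)) hs)))

swapPair : ∀ {m} → MomentPair m → MomentPair m
swapPair P = record { gs = hs ; hs = gs ; ∣gs∣ = ∣hs∣ ; ∣hs∣ = ∣gs∣ ; gs< = hs< ; hs< = gs< ; moments = sym ∘ moments }
  where open MomentPair P

module _ {m : ℕ} (P : MomentPair m) where
  open MomentPair P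

  -- The test value has absolute value 2^m K |t| and is at most 2nW, which is less than 2^m K; so
  -- the integer `t` is zero.
  alternating-vanish : ∀ u v w W K t → (∀ {d} → d < 3 + m → ∣ alternatingQuadratic u v w d ∣ ≤ W) →
    Λ (alternatingQuadratic u v w) ≡ -[1+ 1 ] ℤ.^ m ℤ.* (+ K ℤ.* t) →
    ((3 + m) + (3 + m)) * W < 2 ^ m * K → t ≡ 0ℤ
  alternating-vanish u v w W K t bound eq small = k*∣i∣<k⇒i≡0 (2 ^ m * K) t (begin-strict
    2 ^ m * K * ∣ t ∣                              ≡⟨ *-assoc (2 ^ m) K ∣ t ∣ ⟩
    2 ^ m * (K * ∣ t ∣)                            ≡⟨ cong₂ _*_ (∣-2^m∣ m) (ℤ.abs-* (+ K) t) ⟨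
    ∣ -[1+ 1 ] ℤ.^ m ∣ * ∣ + K ℤ.* t ∣             ≡⟨ ℤ.abs-* (-[1+ 1 ] ℤ.^ m) (+ K ℤ.* t) ⟨
    ∣ -[1+ 1 ] ℤ.^ m ℤ.* (+ K ℤ.* t) ∣             ≡⟨ cong ∣_∣ eq ⟨
    ∣ Λ (alternatingQuadratic u v w) ∣             ≤⟨ ∣Λ∣≤ (alternatingQuadratic u v w) W bound ⟩
    ((3 + m) + (3 + m)) * W                        <⟨ small ⟩
    2 ^ m * K                                      ∎)
    where open ≤-Reasoning

  -- The test function (-1)^d evaluates the generating function at t = -1.
  a≡2b-4c : (3 + m) + (3 + m) < 2 ^ m → a ≡ + 2 ℤ.* b ℤ.- + 4 ℤ.* c
  a≡2b-4c small = ℤ.i-j≡0⇒i≡j a _ (alternating-vanish 1ℤ 0ℤ 0ℤ 1 1 (a ℤ.- (+ 2 ℤ.* b ℤ.- + 4 ℤ.* c))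
    (λ {d} _ → ≤-reflexive (trans (∣alternating*∣ d _) (cong ∣_∣ (value (+ d)))))
    (trans (Λ-alternatingQuadratic 1ℤ 0ℤ 0ℤ) (cong (-[1+ 1 ] ℤ.^ m ℤ.*_) (identity a b c (+ m))))
    (subst₂ _<_ (sym (*-identityʳ _)) (sym (*-identityʳ _)) small))
    where
    value : ∀ x → 1ℤ ℤ.+ 0ℤ ℤ.* (+ 2 ℤ.* x) ℤ.+ 0ℤ ℤ.* (+ 4 ℤ.* (x ℤ.* (x ℤ.- 1ℤ))) ≡ 1ℤ
    value = ℤ-Solver.solve-∀
    identity : ∀ a b c x → a ℤ.* (1ℤ ℤ.+ 0ℤ ℤ.* x ℤ.+ 0ℤ ℤ.* (x ℤ.* (x ℤ.- 1ℤ)))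
      ℤ.- + 2 ℤ.* (b ℤ.* (1ℤ ℤ.+ 0ℤ ℤ.* (1ℤ ℤ.+ x) ℤ.+ 0ℤ ℤ.* ((1ℤ ℤ.+ x) ℤ.* ((1ℤ ℤ.+ x) ℤ.- 1ℤ))))
      ℤ.+ + 4 ℤ.* (c ℤ.* (1ℤ ℤ.+ 0ℤ ℤ.* (+ 2 ℤ.+ x) ℤ.+ 0ℤ ℤ.* ((+ 2 ℤ.+ x) ℤ.* ((+ 2 ℤ.+ x) ℤ.- 1ℤ))))
      ≡ 1ℤ ℤ.* (a ℤ.- (+ 2 ℤ.* b ℤ.- + 4 ℤ.* c))
    identity = ℤ-Solver.solve-∀

  -- The test function (-1)^d (2d - (m + 2)) is centred on the degree range, where it stays within m
  -- + 2.
  b≡4c : a ≡ + 2 ℤ.* b ℤ.- + 4 ℤ.* c → ((3 + m) + (3 + m)) * (2 + m) < 2 ^ m * 2 → b ≡ + 4 ℤ.* c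
  b≡4c a≡ small = ℤ.i-j≡0⇒i≡j b _ (trans (negate b (+ 4 ℤ.* c)) (cong ℤ.-_ 
    (alternating-vanish (ℤ.- + (2 + m)) 1ℤ 0ℤ (2 + m) 2 (+ 4 ℤ.* c ℤ.- b)
    (λ {d} d< → ≤-trans (≤-reflexive (∣alternating*∣ d _)) (∣linear∣≤ (2 + m) (s≤s⁻¹ d<)))
    (trans (Λ-alternatingQuadratic (ℤ.- + (2 + m)) 1ℤ 0ℤ) (cong (-[1+ 1 ] ℤ.^ m ℤ.*_)
      (trans (cong (λ a → a ℤ.* p (+ m) ℤ.- + 2 ℤ.* (b ℤ.* p (1ℤ ℤ.+ + m)) ℤ.+ + 4 ℤ.* (c ℤ.* p (+ 2 ℤ.+ + m))) a≡)
        (identity b c (+ m)))))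
    small)))
    where
    p : ℤ → ℤ
    p x = (ℤ.- + (2 + m)) ℤ.+ 1ℤ ℤ.* x ℤ.+ 0ℤ ℤ.* (x ℤ.* (x ℤ.- 1ℤ))
    negate : ∀ x y → x ℤ.- y ≡ ℤ.- (y ℤ.- x)
    negate = ℤ-Solver.solve-∀
    identity : ∀ b c x → (+ 2 ℤ.* b ℤ.- + 4 ℤ.* c) ℤ.* ((ℤ.- (+ 2 ℤ.+ x)) ℤ.+ 1ℤ ℤ.* x ℤ.+ 0ℤ ℤ.* (x ℤ.* (x ℤ.- 1ℤ)))
      ℤ.- + 2 ℤ.* (b ℤ.* ((ℤ.- (+ 2 ℤ.+ x)) ℤ.+ 1ℤ ℤ.* (1ℤ ℤ.+ x) ℤ.+ 0ℤ ℤ.* ((1ℤ ℤ.+ x) ℤ.* ((1ℤ ℤ.+ x) ℤ.- 1ℤ))))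
      ℤ.+ + 4 ℤ.* (c ℤ.* ((ℤ.- (+ 2 ℤ.+ x)) ℤ.+ 1ℤ ℤ.* (+ 2 ℤ.+ x) ℤ.+ 0ℤ ℤ.* ((+ 2 ℤ.+ x) ℤ.* ((+ 2 ℤ.+ x) ℤ.- 1ℤ))))
      ≡ + 2 ℤ.* (+ 4 ℤ.* c ℤ.- b)
    identity = ℤ-Solver.solve-∀

  -- With N = m + 2 the polynomial factor of the test function is -N² T₂((2d - N) / N), a rescaled
  -- Chebyshev polynomial, hence within N² on the degree range. As a = b = 4c, the test value is
  -- (-2)^m times 4c times the second difference of `p`, which is -4.
  c≡0 : a ≡ + 4 ℤ.* c → b ≡ + 4 ℤ.* c → ((3 + m) + (3 + m)) * ((2 + m) * (2 + m)) < 2 ^ m * 16 → c ≡ 0ℤ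
  c≡0 a≡ b≡ small = trans (sym (ℤ.neg-involutive c)) (cong ℤ.-_
    (alternating-vanish u v -[1+ 1 ] ((2 + m) * (2 + m)) 16 (ℤ.- c)
    (λ {d} d< → ≤-trans (≤-reflexive (∣alternating*∣ d _)) (∣quadratic∣≤ (2 + m) (s≤s⁻¹ d<)))
    (trans (Λ-alternatingQuadratic u v -[1+ 1 ]) (cong (-[1+ 1 ] ℤ.^ m ℤ.*_)
      (trans (cong₂ (λ a b → a ℤ.* p (+ m) ℤ.- + 2 ℤ.* (b ℤ.* p (1ℤ ℤ.+ + m)) ℤ.+ + 4 ℤ.* (c ℤ.* p (+ 2 ℤ.+ + m))) a≡ b≡)
        (identity c (+ m)))))
    small))
    where
    u = ℤ.- (+ (2 + m) ℤ.* + (2 + m))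
    v = + 4 ℤ.* (+ (2 + m) ℤ.- 1ℤ)
    p : ℤ → ℤ
    p x = u ℤ.+ v ℤ.* x ℤ.+ -[1+ 1 ] ℤ.* (x ℤ.* (x ℤ.- 1ℤ))
    identity : ∀ c x → let n = + 2 ℤ.+ x
                           u = ℤ.- (n ℤ.* n)
                           v = + 4 ℤ.* (n ℤ.- 1ℤ) in
      (+ 4 ℤ.* c) ℤ.* (u ℤ.+ v ℤ.* x ℤ.+ -[1+ 1 ] ℤ.* (x ℤ.* (x ℤ.- 1ℤ)))
      ℤ.- + 2 ℤ.* ((+ 4 ℤ.* c) ℤ.* (u ℤ.+ v ℤ.* (1ℤ ℤ.+ x) ℤ.+ -[1+ 1 ] ℤ.* ((1ℤ ℤ.+ x) ℤ.* ((1ℤ ℤ.+ x) ℤ.- 1ℤ))))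
      ℤ.+ + 4 ℤ.* (c ℤ.* (u ℤ.+ v ℤ.* (+ 2 ℤ.+ x) ℤ.+ -[1+ 1 ] ℤ.* ((+ 2 ℤ.+ x) ℤ.* ((+ 2 ℤ.+ x) ℤ.- 1ℤ))))
      ≡ + 16 ℤ.* (ℤ.- c)
    identity = ℤ-Solver.solve-∀

  b≡4c⇒a≡4c : a ≡ + 2 ℤ.* b ℤ.- + 4 ℤ.* c → b ≡ + 4 ℤ.* c → a ≡ + 4 ℤ.* c
  b≡4c⇒a≡4c a≡ b≡ = trans a≡ (trans (cong (λ b → + 2 ℤ.* b ℤ.- + 4 ℤ.* c) b≡) (identity c))
    where
    identity : ∀ c → + 2 ℤ.* (+ 4 ℤ.* c) ℤ.- + 4 ℤ.* c ≡ + 4 ℤ.* c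
    identity = ℤ-Solver.solve-∀

  c≡0⇒↭ : a ≡ + 4 ℤ.* c → b ≡ + 4 ℤ.* c → c ≡ 0ℤ → gs ↭ hs
  c≡0⇒↭ a≡ b≡ c≡ = Λ≡0⇒↭ λ F → trans (Λ-newton F)
    (cong₂ ℤ._+_ (cong₂ ℤ._+_ (cong (ℤ._* Δ₀ m F) (trans a≡ (cong (+ 4 ℤ.*_) c≡)))
      (cong (ℤ._* Δ₀ (1 + m) F) (trans b≡ (cong (+ 4 ℤ.*_) c≡)))) (cong (ℤ._* Δ₀ (2 + m) F) c≡))

  signs-bound : ∀ xs {_ : True (All.all? (λ x → ∣ x ∣ ≤? 1) xs)} k t →
    Λ (table xs) ≡ k ℤ.* t → ∣ k ∣ * ∣ t ∣ ≤ (3 + m) + (3 + m)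
  signs-bound xs {b} k t eq = begin
    ∣ k ∣ * ∣ t ∣           ≡⟨ ℤ.abs-* k t ⟨
    ∣ k ℤ.* t ∣             ≡⟨ cong ∣_∣ eq ⟨
    ∣ Λ (table xs) ∣        ≤⟨ ∣Λ∣≤ (table xs) 1 (λ {d} _ → ∣table∣≤ (toWitness b) d) ⟩
    ((3 + m) + (3 + m)) * 1 ≡⟨ *-identityʳ _ ⟩
    (3 + m) + (3 + m)       ∎
    where open ≤-Reasoning

-- Lists of length n ≥ 10, n = 8, n = 9 and n = 7

n≥10⇒↭ : ∀ m (P : MomentPair (7 + m)) → MomentPair.gs P ↭ MomentPair.hs P
n≥10⇒↭ m P = c≡0⇒↭ P a≡4c b≡ (c≡0 P a≡4c b≡ (quadratic-bound m))
  where
  a≡ = a≡2b-4c P (2*[7+m]<2^[4+m] (3 + m))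
  b≡ = b≡4c P a≡ (linear-bound m)
  a≡4c = b≡4c⇒a≡4c P a≡ b≡

-- In the cases n = 8, 9 and 7 the test vectors are the signs of the coefficients of (1 − t)^(m+1) (1 + t), which
-- isolates b − 4c = ±(α − γ), and of (1 − t)^m (1 + t)², which isolates b − 2c = ±(α + γ).
n≡8⇒↭ : (P : MomentPair 5) → MomentPair.gs P ↭ MomentPair.hs P
n≡8⇒↭ P = c≡0⇒↭ P a≡4c b≡ c≡
  where
  open MomentPair P
  -- The numerals are the differences of orders 5, 6 and 7 at 0 of the two sign vectors below.
  -- Either test bounds 20 times the absolute value of an integer by 2n = 16.
  linear : ∀ b c → (+ 2 ℤ.* b ℤ.- + 4 ℤ.* c) ℤ.* -[1+ 19 ] ℤ.+ b ℤ.* + 20 ℤ.+ c ℤ.* 0ℤ ≡ -[1+ 19 ] ℤ.* (b ℤ.- + 4 ℤ.* c)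
  linear = ℤ-Solver.solve-∀
  quadratic : ∀ c → (+ 4 ℤ.* c) ℤ.* -[1+ 1 ] ℤ.+ (+ 4 ℤ.* c) ℤ.* -[1+ 5 ] ℤ.+ c ℤ.* + 12 ≡ -[1+ 19 ] ℤ.* c
  quadratic = ℤ-Solver.solve-∀
  a≡ = a≡2b-4c P (2*[7+m]<2^[4+m] 1)
  δ≤ = signs-bound P (1ℤ ∷ -1ℤ ∷ 1ℤ ∷ -1ℤ ∷ -1ℤ ∷ 1ℤ ∷ -1ℤ ∷ 1ℤ ∷ []) -[1+ 19 ] (b ℤ.- + 4 ℤ.* c)
    (trans (Λ-newton _) (trans (cong (λ a → a ℤ.* -[1+ 19 ] ℤ.+ b ℤ.* + 20 ℤ.+ c ℤ.* 0ℤ) a≡) (linear b c)))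
  b≡ = ℤ.i-j≡0⇒i≡j b (+ 4 ℤ.* c) (k*∣i∣<k⇒i≡0 20 _ (≤-<-trans δ≤ (m≤m+n 17 3)))
  a≡4c = b≡4c⇒a≡4c P a≡ b≡
  c≤ = signs-bound P (1ℤ ∷ -1ℤ ∷ 1ℤ ∷ 1ℤ ∷ -1ℤ ∷ -1ℤ ∷ 1ℤ ∷ -1ℤ ∷ []) -[1+ 19 ] c
    (trans (Λ-newton _) (trans (cong₂ (λ a b → a ℤ.* -[1+ 1 ] ℤ.+ b ℤ.* -[1+ 5 ] ℤ.+ c ℤ.* + 12) a≡4c b≡) (quadratic c)))
  c≡ = k*∣i∣<k⇒i≡0 20 c (≤-<-trans c≤ (m≤m+n 17 3))

n≡9⇒↭ : (P : MomentPair 6) → MomentPair.gs P ↭ MomentPair.hs P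
n≡9⇒↭ P = c≡0⇒↭ P a≡4c b≡ c≡
  where
  open MomentPair P
  linear : ∀ b c → (+ 2 ℤ.* b ℤ.- + 4 ℤ.* c) ℤ.* + 35 ℤ.+ b ℤ.* -[1+ 34 ] ℤ.+ c ℤ.* 0ℤ ≡ + 35 ℤ.* (b ℤ.- + 4 ℤ.* c)
  linear = ℤ-Solver.solve-∀
  quadratic : ∀ c → (+ 4 ℤ.* c) ℤ.* -[1+ 17 ] ℤ.+ (+ 4 ℤ.* c) ℤ.* + 54 ℤ.+ c ℤ.* -[1+ 107 ] ≡ + 36 ℤ.* c
  quadratic = ℤ-Solver.solve-∀
  a≡ = a≡2b-4c P (2*[7+m]<2^[4+m] 2)
  δ≤ = signs-bound P (1ℤ ∷ -1ℤ ∷ 1ℤ ∷ -1ℤ ∷ 0ℤ ∷ 1ℤ ∷ -1ℤ ∷ 1ℤ ∷ -1ℤ ∷ []) (+ 35) (b ℤ.- + 4 ℤ.* c)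
    (trans (Λ-newton _) (trans (cong (λ a → a ℤ.* + 35 ℤ.+ b ℤ.* -[1+ 34 ] ℤ.+ c ℤ.* 0ℤ) a≡) (linear b c)))
  b≡ = ℤ.i-j≡0⇒i≡j b (+ 4 ℤ.* c) (k*∣i∣<k⇒i≡0 35 _ (≤-<-trans δ≤ (m≤m+n 19 16)))
  a≡4c = b≡4c⇒a≡4c P a≡ b≡
  c≤ = signs-bound P (1ℤ ∷ -1ℤ ∷ 1ℤ ∷ 1ℤ ∷ -1ℤ ∷ 1ℤ ∷ 1ℤ ∷ -1ℤ ∷ 1ℤ ∷ []) (+ 36) c
    (trans (Λ-newton _) (trans (cong₂ (λ a b → a ℤ.* -[1+ 17 ] ℤ.+ b ℤ.* + 54 ℤ.+ c ℤ.* -[1+ 107 ]) a≡4c b≡) (quadratic c)))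
  c≡ = k*∣i∣<k⇒i≡0 36 c (≤-<-trans c≤ (m≤m+n 19 17))

-- extreme: the differences of the multiplicities are 1, −2, −1, 4, −1, −2, 1.
-- split: they are 1, −3, 2, 2, −3, 1, 0 for p = 1 and 0, 1, −3, 2, 2, −3, 1 for p = 2.
data Exception (gs hs : List ℕ) : Set where
  extreme : 0 < multiplicity 0 gs → 0 < multiplicity 6 gs → Exception gs hs
  split   : ∀ p → p ≡ 1 ⊎ p ≡ 2 → 3 ≤ multiplicity p hs → 3 ≤ multiplicity (3 + p) hs →
            sumOver id gs ≡ sumOver id hs → suc (sumOver (_∸ 3) gs) ≡ sumOver (_∸ 3) hs → Exception gs hs

-- These are the integer pairs with |δ| ≤ 1 and |δ + 2c| ≤ 2. The two signs differ by exchanging the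
-- lists; `low` leads to p = 1 and `high` to p = 2.
data Case : (δ c : ℤ) → Set where
  trivial  : Case 0ℤ 0ℤ
  extreme⁺ : Case 0ℤ 1ℤ
  extreme⁻ : Case 0ℤ -1ℤ
  low⁺     : Case 1ℤ 0ℤ
  low⁻     : Case -1ℤ 0ℤ
  high⁺    : Case -1ℤ 1ℤ
  high⁻    : Case 1ℤ -1ℤ

classify : ∀ δ c → ∣ δ ∣ < 2 → ∣ δ ℤ.+ + 2 ℤ.* c ∣ < 3 → Case δ c
classify δ c δ< σ< = go δ c δ< c< σ<
  where
  identity : ∀ δ c → + 2 ℤ.* c ≡ (δ ℤ.+ + 2 ℤ.* c) ℤ.- δ
  identity = ℤ-Solver.solve-∀
  c< : ∣ c ∣ < 2
  c< = *-cancelˡ-< 2 ∣ c ∣ 2 (begin-strict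
    2 * ∣ c ∣                           ≡⟨ ℤ.abs-* (+ 2) c ⟨
    ∣ + 2 ℤ.* c ∣                       ≡⟨ cong ∣_∣ (identity δ c) ⟩
    ∣ (δ ℤ.+ + 2 ℤ.* c) ℤ.- δ ∣         ≤⟨ ℤ.∣i-j∣≤∣i∣+∣j∣ (δ ℤ.+ + 2 ℤ.* c) δ ⟩
    ∣ δ ℤ.+ + 2 ℤ.* c ∣ + ∣ δ ∣         <⟨ +-mono-≤ σ< (s≤s⁻¹ δ<) ⟩
    4                                   ∎)
    where open ≤-Reasoning
  go : ∀ δ c → ∣ δ ∣ < 2 → ∣ c ∣ < 2 → ∣ δ ℤ.+ + 2 ℤ.* c ∣ < 3 → Case δ c
  go (+ 0) (+ 0) _ _ _ = trivial
  go (+ 0) (+ 1) _ _ _ = extreme⁺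
  go (+ 0) -[1+ 0 ] _ _ _ = extreme⁻
  go (+ 1) (+ 0) _ _ _ = low⁺
  go (+ 1) (+ 1) _ _ (s≤s (s≤s (s≤s ())))
  go (+ 1) -[1+ 0 ] _ _ _ = high⁻
  go -[1+ 0 ] (+ 0) _ _ _ = low⁻
  go -[1+ 0 ] (+ 1) _ _ _ = high⁺
  go -[1+ 0 ] -[1+ 0 ] _ _ (s≤s (s≤s (s≤s ())))
  go (+ suc (suc _)) _ (s≤s (s≤s ())) _ _
  go -[1+ suc _ ] _ (s≤s (s≤s ())) _ _
  go _ (+ suc (suc _)) _ (s≤s (s≤s ())) _
  go _ -[1+ suc _ ] _ (s≤s (s≤s ())) _

module _ (P : MomentPair 4) where
  open MomentPair P

  -- For numerals `x`, `y`, `z` the last hypothesis is a closed computation. Moving the negative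
  -- part across turns it into an equation of natural numbers.
  Λ-pos : ∀ {x y z} → a ≡ x → b ≡ y → c ≡ z → ∀ (f : ℕ → ℕ) k l →
    x ℤ.* Δ₀ 4 (+_ ∘ f) ℤ.+ y ℤ.* Δ₀ 5 (+_ ∘ f) ℤ.+ z ℤ.* Δ₀ 6 (+_ ∘ f) ≡ + k ℤ.- + l →
    sumOver f gs + l ≡ k + sumOver f hs
  Λ-pos refl refl refl f k l eq = ℤ.+-injective (rearrange (+ sumOver f gs) (+ sumOver f hs) (+ k) (+ l)
    (trans (sym (cong₂ ℤ._-_ (total-pos f gs) (total-pos f hs))) (trans (Λ-newton (+_ ∘ f)) eq)))
    where
    identity₁ : ∀ x y l → x ℤ.+ l ≡ (x ℤ.- y) ℤ.+ (y ℤ.+ l)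
    identity₁ = ℤ-Solver.solve-∀
    identity₂ : ∀ k l y → (k ℤ.- l) ℤ.+ (y ℤ.+ l) ≡ k ℤ.+ y
    identity₂ = ℤ-Solver.solve-∀
    rearrange : ∀ x y k l → x ℤ.- y ≡ k ℤ.- l → x ℤ.+ l ≡ k ℤ.+ y
    rearrange x y k l eq = trans (identity₁ x y l) (trans (cong (ℤ._+ (y ℤ.+ l)) eq) (identity₂ k l y))

  extreme-exception : a ≡ + 4 → b ≡ + 4 → c ≡ + 1 → Exception gs hs
  extreme-exception a≡ b≡ c≡ = extreme
    (≤-trans (s≤s z≤n) (≤-reflexive (sym (trans (sym (+-identityʳ _)) (Λ-pos a≡ b≡ c≡ (χ ∘ (_≡ᵇ 0)) 1 0 refl)))))
    (≤-trans (s≤s z≤n) (≤-reflexive (sym (trans (sym (+-identityʳ _)) (Λ-pos a≡ b≡ c≡ (χ ∘ (_≡ᵇ 6)) 1 0 refl)))))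

  split-exception : ∀ p → p ≡ 1 ⊎ p ≡ 2 → ∀ {x y z} → a ≡ x → b ≡ y → c ≡ z →
    let Σ = λ (f : ℕ → ℕ) → x ℤ.* Δ₀ 4 (+_ ∘ f) ℤ.+ y ℤ.* Δ₀ 5 (+_ ∘ f) ℤ.+ z ℤ.* Δ₀ 6 (+_ ∘ f) in
    Σ (χ ∘ (_≡ᵇ p)) ≡ + 0 ℤ.- + 3 → Σ (χ ∘ (_≡ᵇ (3 + p))) ≡ + 0 ℤ.- + 3 →
    Σ id ≡ + 0 ℤ.- + 0 → Σ (_∸ 3) ≡ + 0 ℤ.- + 1 → Exception gs hs
  split-exception p p≡ a≡ b≡ c≡ e₁ e₂ e₃ e₄ = split p p≡
    (≤-trans (m≤n+m 3 _) (≤-reflexive (Λ-pos a≡ b≡ c≡ _ 0 3 e₁)))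
    (≤-trans (m≤n+m 3 _) (≤-reflexive (Λ-pos a≡ b≡ c≡ _ 0 3 e₂)))
    (trans (sym (+-identityʳ _)) (Λ-pos a≡ b≡ c≡ id 0 0 e₃))
    (trans (+-comm 1 _) (Λ-pos a≡ b≡ c≡ (_∸ 3) 0 1 e₄))

  swap-μ : ∀ j {x} → μ j ≡ x → MomentPair.μ (swapPair P) j ≡ ℤ.- x
  swap-μ j refl = identity (+ sumOver (_C j) gs) (+ sumOver (_C j) hs)
    where
    identity : ∀ x y → y ℤ.- x ≡ ℤ.- (x ℤ.- y)
    identity = ℤ-Solver.solve-∀

n≡7⇒↭⊎Exception : (P : MomentPair 4) → let open MomentPair P in gs ↭ hs ⊎ Exception gs hs ⊎ Exception hs gs
-- The tests give 10 |δ| ≤ 14 and 6 |δ + 2c| ≤ 14, which leaves nonzero integers possible.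
n≡7⇒↭⊎Exception P = conclude δ c (classify δ c
    (*-cancelˡ-< 10 ∣ δ ∣ 2 (≤-<-trans δ≤ (m≤m+n 15 5)))
    (*-cancelˡ-< 6 ∣ δ ℤ.+ + 2 ℤ.* c ∣ 3 (≤-<-trans σ≤ (m≤m+n 15 3))))
  a≡ (b≡ b c) refl
  where
  open MomentPair P
  δ = b ℤ.- + 4 ℤ.* c
  b≡ : ∀ b c → b ≡ (b ℤ.- + 4 ℤ.* c) ℤ.+ + 4 ℤ.* c
  b≡ = ℤ-Solver.solve-∀
  linear : ∀ b c → (+ 2 ℤ.* b ℤ.- + 4 ℤ.* c) ℤ.* + 10 ℤ.+ b ℤ.* -[1+ 9 ] ℤ.+ c ℤ.* 0ℤ ≡ + 10 ℤ.* (b ℤ.- + 4 ℤ.* c)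
  linear = ℤ-Solver.solve-∀
  quadratic : ∀ b c →
    (+ 2 ℤ.* b ℤ.- + 4 ℤ.* c) ℤ.* -[1+ 5 ] ℤ.+ b ℤ.* + 18 ℤ.+ c ℤ.* -[1+ 35 ] ≡ + 6 ℤ.* ((b ℤ.- + 4 ℤ.* c) ℤ.+ + 2 ℤ.* c)
  quadratic = ℤ-Solver.solve-∀
  2b-4c≡a = a≡2b-4c P (2*[7+m]<2^[4+m] 0)
  identity : ∀ b c → + 2 ℤ.* b ℤ.- + 4 ℤ.* c ≡ + 2 ℤ.* (b ℤ.- + 4 ℤ.* c) ℤ.+ + 4 ℤ.* c
  identity = ℤ-Solver.solve-∀
  a≡ = trans 2b-4c≡a (identity b c)
  δ≤ = signs-bound P (1ℤ ∷ -1ℤ ∷ 1ℤ ∷ 0ℤ ∷ -1ℤ ∷ 1ℤ ∷ -1ℤ ∷ []) (+ 10) δ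
    (trans (Λ-newton _) (trans (cong (λ a → a ℤ.* + 10 ℤ.+ b ℤ.* -[1+ 9 ] ℤ.+ c ℤ.* 0ℤ) 2b-4c≡a) (linear b c)))
  σ≤ = signs-bound P (1ℤ ∷ -1ℤ ∷ -1ℤ ∷ 1ℤ ∷ -1ℤ ∷ -1ℤ ∷ 1ℤ ∷ []) (+ 6) (δ ℤ.+ + 2 ℤ.* c)
    (trans (Λ-newton _) (trans (cong (λ a → a ℤ.* -[1+ 5 ] ℤ.+ b ℤ.* + 18 ℤ.+ c ℤ.* -[1+ 35 ]) 2b-4c≡a) (quadratic b c)))
  -- Fresh variables tied to `δ` and `c` by equations make it possible to match on `Case`.
  conclude : ∀ δ′ c′ → Case δ′ c′ → a ≡ + 2 ℤ.* δ′ ℤ.+ + 4 ℤ.* c′ → b ≡ δ′ ℤ.+ + 4 ℤ.* c′ → c ≡ c′ →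
    gs ↭ hs ⊎ Exception gs hs ⊎ Exception hs gs
  conclude _ _ trivial  a≡ b≡ c≡ = inj₁
    (c≡0⇒↭ P (trans a≡ (sym (cong (+ 4 ℤ.*_) c≡))) (trans b≡ (sym (cong (+ 4 ℤ.*_) c≡))) c≡)
  conclude _ _ extreme⁺ a≡ b≡ c≡ = inj₂ (inj₁ (extreme-exception P a≡ b≡ c≡))
  conclude _ _ extreme⁻ a≡ b≡ c≡ = inj₂ (inj₂
    (extreme-exception (swapPair P) (swap-μ P 4 a≡) (swap-μ P 5 b≡) (swap-μ P 6 c≡)))
  conclude _ _ low⁺     a≡ b≡ c≡ = inj₂ (inj₁ (split-exception P 1 (inj₁ refl) a≡ b≡ c≡ refl refl refl refl))
  conclude _ _ low⁻     a≡ b≡ c≡ = inj₂ (inj₂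
    (split-exception (swapPair P) 1 (inj₁ refl) (swap-μ P 4 a≡) (swap-μ P 5 b≡) (swap-μ P 6 c≡) refl refl refl refl))
  conclude _ _ high⁺    a≡ b≡ c≡ = inj₂ (inj₁ (split-exception P 2 (inj₂ refl) a≡ b≡ c≡ refl refl refl refl))
  conclude _ _ high⁻    a≡ b≡ c≡ = inj₂ (inj₂
    (split-exception (swapPair P) 2 (inj₂ refl) (swap-μ P 4 a≡) (swap-μ P 5 b≡) (swap-μ P 6 c≡) refl refl refl refl))

-- Seven vertices

sum-mono : {f g : Fin n → ℕ} → (∀ i → f i ≤ g i) → ∑.sum f ≤ ∑.sum g
sum-mono {zero}  f≤g = z≤n
sum-mono {suc n} f≤g = +-mono-≤ (f≤g zero) (sum-mono (f≤g ∘ suc))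

term≤sum : ∀ (f : Fin n → ℕ) i → f i ≤ ∑.sum f
term≤sum f zero    = m≤m+n _ _
term≤sum f (suc i) = ≤-trans (term≤sum (f ∘ suc) i) (m≤n+m _ _)

two-terms≤sum : ∀ (f : Fin n → ℕ) {i j} → ¬ i ≡ j → f i + f j ≤ ∑.sum f
two-terms≤sum f {zero}  {zero}  i≢j = contradiction refl i≢j
two-terms≤sum f {zero}  {suc j} i≢j = +-monoʳ-≤ (f zero) (term≤sum (f ∘ suc) j)
two-terms≤sum f {suc i} {zero}  i≢j =
  ≤-trans (≤-reflexive (+-comm (f (suc i)) (f zero))) (+-monoʳ-≤ (f zero) (term≤sum (f ∘ suc) i))
two-terms≤sum f {suc i} {suc j} i≢j = ≤-trans (two-terms≤sum (f ∘ suc) (i≢j ∘ cong suc)) (m≤n+m _ (f zero))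

sum-squeeze : ∀ {f g : Fin n → ℕ} → (∀ i → f i ≤ g i) → ∑.sum g ≤ ∑.sum f → ∀ i → f i ≡ g i
sum-squeeze {f = f} {g} f≤g ∑g≤∑f zero = ≤-antisym (f≤g zero)
  (+-cancelʳ-≤ (∑.sum (f ∘ suc)) _ _ (≤-trans (+-monoʳ-≤ (g zero) (sum-mono (f≤g ∘ suc))) ∑g≤∑f))
sum-squeeze {f = f} {g} f≤g ∑g≤∑f (suc i) = sum-squeeze (f≤g ∘ suc)
  (+-cancelˡ-≤ (f zero) _ _ (≤-trans (+-monoˡ-≤ (∑.sum (g ∘ suc)) (f≤g zero)) ∑g≤∑f)) i

sum-one : ∀ n → ∑.sum {n} (const 1) ≡ n
sum-one zero    = refl
sum-one (suc n) = cong suc (sum-one n)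

χ-not : ∀ b → χ b + χ (not b) ≡ 1
χ-not true  = refl
χ-not false = refl

χ≤1 : ∀ b → χ b ≤ 1
χ≤1 true  = s≤s z≤n
χ≤1 false = z≤n

nonDegree : Graph n → Fin n → ℕ
nonDegree G v = ∑.sum (λ u → χ (not (adj G v u)))

degree+nonDegree : ∀ (G : Graph n) v → degree G v + nonDegree G v ≡ n
degree+nonDegree {n} G v = begin
  degree G v + nonDegree G v                                       ≡⟨ cong (_+ nonDegree G v) (degree-∑ G v) ⟩
  ∑.sum (χ ∘ adj G v) + nonDegree G v                              ≡⟨ ∑.∑-distrib-+ (χ ∘ adj G v) _ ⟨
  ∑.sum (λ u → χ (adj G v u) + χ (not (adj G v u)))                ≡⟨ ∑.sum-cong-≗ (λ u → χ-not (adj G v u)) ⟩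
  ∑.sum {n} (const 1)                                              ≡⟨ sum-one n ⟩
  n                                                                ∎
  where open ≡-Reasoning

degree<n : ∀ (G : Graph n) v → degree G v < n
degree<n G v = begin-strict
  degree G v                          <⟨ m<m+n (degree G v) {1} (s≤s z≤n) ⟩
  degree G v + 1                      ≡⟨ cong (λ b → degree G v + χ (not b)) (adj-irrefl G v) ⟨
  degree G v + χ (not (adj G v v))    ≤⟨ +-monoʳ-≤ (degree G v) (term≤sum (λ u → χ (not (adj G v u))) v) ⟩
  degree G v + nonDegree G v          ≡⟨ degree+nonDegree G v ⟩
  _                                   ∎
  where open ≤-Reasoning

-- Neither `v` itself nor the isolated vertex `u` is a neighbour of `v`.
isolated⇒degree≤n-2 : ∀ (G : Graph n) u v → degree G u ≡ 0 → 0 < degree G v → degree G v + 2 ≤ n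
isolated⇒degree≤n-2 {n} G u v du dv = begin
  degree G v + 2
    ≡⟨ cong₂ (λ b c → degree G v + (χ (not b) + χ (not c))) vu (adj-irrefl G v) ⟨
  degree G v + (χ (not (adj G v u)) + χ (not (adj G v v)))
    ≤⟨ +-monoʳ-≤ (degree G v) (two-terms≤sum (λ w → χ (not (adj G v w))) u≢v) ⟩
  degree G v + nonDegree G v
    ≡⟨ degree+nonDegree G v ⟩
  n ∎
  where
  open ≤-Reasoning
  u≢v : ¬ u ≡ v
  u≢v refl = <⇒≢ dv (sym du)
  vu : adj G v u ≡ false
  vu with adj G u v in eq
  ... | false = trans (adj-sym G v u) eq
  ... | true  = contradiction (≤-trans (term≤sum (χ ∘ adj G u) v) (≤-reflexive (trans (sym (degree-∑ G u)) du)))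
                  (subst (λ b → ¬ χ b ≤ 0) (sym eq) λ ())

-- Edge counts within and between vertex sets

module _ (G : Graph n) where

  size : (Fin n → Bool) → ℕ
  size P = ∑.sum (χ ∘ P)

  degreeSum : (Fin n → Bool) → ℕ
  degreeSum P = ∑.sum (λ u → χ (P u) * degree G u)

  -- Ordered pairs, so edges inside P are counted twice in edges P P.
  edges nonEdges : (P Q : Fin n → Bool) → ℕ
  edges    P Q = ∑.sum (λ u → χ (P u) * ∑.sum (λ v → χ (Q v) * χ (adj G u v)))
  nonEdges P Q = ∑.sum (λ u → χ (P u) * ∑.sum (λ v → χ (Q v) * χ (not (adj G u v))))

  edges-sym : ∀ P Q → edges P Q ≡ edges Q P
  edges-sym P Q = begin
    edges P Q
      ≡⟨ ∑.sum-cong-≗ (λ u → ∑.*-distribˡ-sum (χ (P u)) (λ v → χ (Q v) * χ (adj G u v))) ⟩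
    ∑.sum (λ u → ∑.sum (λ v → χ (P u) * (χ (Q v) * χ (adj G u v))))
      ≡⟨ ∑.∑-comm (λ u v → χ (P u) * (χ (Q v) * χ (adj G u v))) ⟩
    ∑.sum (λ v → ∑.sum (λ u → χ (P u) * (χ (Q v) * χ (adj G u v))))
      ≡⟨ ∑.sum-cong-≗ (λ v → ∑.sum-cong-≗ (λ u → trans (exchange (χ (P u)) (χ (Q v)) (χ (adj G u v)))
           (cong (λ b → χ (Q v) * (χ (P u) * χ b)) (adj-sym G u v)))) ⟩
    ∑.sum (λ v → ∑.sum (λ u → χ (Q v) * (χ (P u) * χ (adj G v u))))
      ≡⟨ ∑.sum-cong-≗ (λ v → ∑.*-distribˡ-sum (χ (Q v)) (λ u → χ (P u) * χ (adj G v u))) ⟨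
    edges Q P ∎
    where
    open ≡-Reasoning
    exchange : ∀ x y z → x * (y * z) ≡ y * (x * z)
    exchange = solve-∀

  degreeSum-split : ∀ P Q → degreeSum P ≡ edges P Q + edges P (not ∘ Q)
  degreeSum-split P Q = begin
    degreeSum P
      ≡⟨ ∑.sum-cong-≗ (λ u → trans (cong (χ (P u) *_) (row u)) (*-distribˡ-+ (χ (P u)) _ _)) ⟩
    ∑.sum (λ u → χ (P u) * ∑.sum (λ v → χ (Q v) * χ (adj G u v)) + χ (P u) * ∑.sum (λ v → χ (not (Q v)) * χ (adj G u v)))
      ≡⟨ ∑.∑-distrib-+ (λ u → χ (P u) * ∑.sum (λ v → χ (Q v) * χ (adj G u v))) _ ⟩
    edges P Q + edges P (not ∘ Q) ∎
    where
    open ≡-Reasoning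
    row : ∀ u → degree G u ≡ ∑.sum (λ v → χ (Q v) * χ (adj G u v)) + ∑.sum (λ v → χ (not (Q v)) * χ (adj G u v))
    row u = trans (degree-∑ G u) (trans
      (∑.sum-cong-≗ (λ v → trans (sym (*-identityˡ (χ (adj G u v)))) (trans (cong (_* χ (adj G u v)) (sym (χ-not (Q v))))
        (*-distribʳ-+ (χ (adj G u v)) (χ (Q v)) (χ (not (Q v)))))))
      (∑.∑-distrib-+ (λ v → χ (Q v) * χ (adj G u v)) _))

  -- The edges between `Q` and its complement contribute equally to both degree sums.
  degreeSum-balance : ∀ Q → degreeSum Q + edges (not ∘ Q) (not ∘ Q) ≡ degreeSum (not ∘ Q) + edges Q Q
  degreeSum-balance Q = begin
    degreeSum Q + e̅
      ≡⟨ cong (_+ e̅) (degreeSum-split Q Q) ⟩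
    edges Q Q + edges Q (not ∘ Q) + e̅
      ≡⟨ cong (λ x → edges Q Q + x + e̅) (edges-sym Q (not ∘ Q)) ⟩
    edges Q Q + edges (not ∘ Q) Q + e̅
      ≡⟨ rearrange (edges Q Q) (edges (not ∘ Q) Q) e̅ ⟩
    (edges (not ∘ Q) Q + e̅) + edges Q Q
      ≡⟨ cong (_+ edges Q Q) (degreeSum-split (not ∘ Q) Q) ⟨
    degreeSum (not ∘ Q) + edges Q Q ∎
    where
    open ≡-Reasoning
    e̅ = edges (not ∘ Q) (not ∘ Q)
    rearrange : ∀ x y z → x + y + z ≡ (y + z) + x
    rearrange = solve-∀

  edges+nonEdges : ∀ P Q → edges P Q + nonEdges P Q ≡ size P * size Q
  edges+nonEdges P Q = begin
    edges P Q + nonEdges P Q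
      ≡⟨ ∑.∑-distrib-+ (λ u → χ (P u) * ∑.sum (λ v → χ (Q v) * χ (adj G u v))) _ ⟨
    ∑.sum (λ u → χ (P u) * ∑.sum (λ v → χ (Q v) * χ (adj G u v)) + χ (P u) * ∑.sum (λ v → χ (Q v) * χ (not (adj G u v))))
      ≡⟨ ∑.sum-cong-≗ (λ u → trans (sym (*-distribˡ-+ (χ (P u)) _ _)) (cong (χ (P u) *_) (row u))) ⟩
    ∑.sum (λ u → χ (P u) * size Q)
      ≡⟨ ∑.*-distribʳ-sum (size Q) (χ ∘ P) ⟨
    size P * size Q ∎
    where
    open ≡-Reasoning
    row : ∀ u → ∑.sum (λ v → χ (Q v) * χ (adj G u v)) + ∑.sum (λ v → χ (Q v) * χ (not (adj G u v))) ≡ size Q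
    row u = trans (sym (∑.∑-distrib-+ (λ v → χ (Q v) * χ (adj G u v)) _))
      (∑.sum-cong-≗ (λ v → trans (sym (*-distribˡ-+ (χ (Q v)) _ _))
        (trans (cong (χ (Q v) *_) (χ-not (adj G u v))) (*-identityʳ _))))

  -- The diagonal pair (u, u) is always a non-edge.
  χ≤nonEdges : ∀ (P : Fin n → Bool) u → χ (P u) ≤ χ (P u) * ∑.sum (λ v → χ (P v) * χ (not (adj G u v)))
  χ≤nonEdges P u with P u in eq
  ... | false = z≤n
  ... | true  = ≤-trans (≤-reflexive (cong₂ (λ b c → χ b * χ (not c)) (sym eq) (sym (adj-irrefl G u))))
    (≤-trans (term≤sum (λ v → χ (P v) * χ (not (adj G u v))) u) (≤-reflexive (sym (+-identityʳ _))))

  edges+size≤ : ∀ P → edges P P + size P ≤ size P * size P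
  edges+size≤ P = ≤-trans (+-monoʳ-≤ (edges P P) (sum-mono (χ≤nonEdges P))) (≤-reflexive (edges+nonEdges P P))

  -- The classical term min(d, |Q|) is weakened to d, but the edges outside `Q` are kept: if the
  -- bound without them is attained, the complement of `Q` is independent.
  ErdősGallai : ∀ Q → degreeSum Q + size Q + edges (not ∘ Q) (not ∘ Q) ≤ degreeSum (not ∘ Q) + size Q * size Q
  ErdősGallai Q = begin
    degreeSum Q + size Q + e̅                     ≡⟨ rearrange (degreeSum Q) (size Q) e̅ ⟩
    (degreeSum Q + e̅) + size Q                   ≡⟨ cong (_+ size Q) (degreeSum-balance Q) ⟩
    degreeSum (not ∘ Q) + edges Q Q + size Q     ≡⟨ +-assoc (degreeSum (not ∘ Q)) _ _ ⟩
    degreeSum (not ∘ Q) + (edges Q Q + size Q)   ≤⟨ +-monoʳ-≤ (degreeSum (not ∘ Q)) (edges+size≤ Q) ⟩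
    degreeSum (not ∘ Q) + size Q * size Q        ∎
    where
    open ≤-Reasoning
    e̅ = edges (not ∘ Q) (not ∘ Q)
    rearrange : ∀ x y z → x + y + z ≡ (x + z) + y
    rearrange = solve-∀

  edges-mono : ∀ {P Q} → (∀ u → χ (P u) ≤ χ (Q u)) → edges P P ≤ edges Q Q
  edges-mono P≤Q = sum-mono (λ u → *-mono-≤ (P≤Q u) (sum-mono (λ v → *-monoˡ-≤ (χ (adj G u v)) (P≤Q v))))

  -- Let R be the intersection. It has no edges, and inside the clique a vertex is non-adjacent only
  -- to itself, so all |R|² ordered pairs are among |R| diagonal ones.
  clique∩independent : ∀ S T → edges S S + size S ≡ size S * size S → edges T T ≡ 0 → size (λ u → S u ∧ T u) ≤ 1
  clique∩independent S T clique independent = r*r≤r⇒r≤1 (size R) (begin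
    size R * size R                ≡⟨ edges+nonEdges R R ⟨
    edges R R + nonEdges R R       ≤⟨ +-mono-≤ (≤-trans (edges-mono R≤T) (≤-reflexive independent)) (sum-mono row≤) ⟩
    size R                         ∎)
    where
    open ≤-Reasoning
    R : Fin n → Bool
    R u = S u ∧ T u
    R≤T : ∀ u → χ (R u) ≤ χ (T u)
    R≤T u with S u
    ... | true  = ≤-refl
    ... | false = z≤n
    R≤S : ∀ u → χ (R u) ≤ χ (S u)
    R≤S u with S u
    ... | true  = χ≤1 (T u)
    ... | false = z≤n
    row : (Fin n → Bool) → Fin n → ℕ
    row P u = ∑.sum (λ v → χ (P v) * χ (not (adj G u v)))
    -- The clique equation makes the sum of the bounds `χ≤nonEdges` tight, hence each of them.
    S-row : ∀ u → χ (S u) ≡ χ (S u) * row S u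
    S-row = sum-squeeze (χ≤nonEdges S) (≤-reflexive (+-cancelˡ-≡ (edges S S) _ _ (trans (edges+nonEdges S S) (sym clique))))
    row≤ : ∀ u → χ (R u) * row R u ≤ χ (R u)
    row≤ u = ≤-trans (*-monoʳ-≤ (χ (R u)) (sum-mono (λ v → *-monoˡ-≤ (χ (not (adj G u v))) (R≤S v))))
      (go (S u) (T u) (S-row u))
      where
      go : ∀ s t → χ s ≡ χ s * row S u → χ (s ∧ t) * row S u ≤ χ (s ∧ t)
      go false t     eq = z≤n
      go true  false eq = z≤n
      go true  true  eq = ≤-reflexive (sym eq)
    r*r≤r⇒r≤1 : ∀ r → r * r ≤ r → r ≤ 1
    r*r≤r⇒r≤1 zero    _  = z≤n
    r*r≤r⇒r≤1 (suc r) le = *-cancelʳ-≤ (suc r) 1 (suc r) (≤-trans le (≤-reflexive (sym (*-identityˡ (suc r)))))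

  size-inclusion-exclusion : ∀ S T → size S + size T + size (λ u → not (S u) ∧ not (T u)) ≡ n + size (λ u → S u ∧ T u)
  size-inclusion-exclusion S T = begin
    size S + size T + size S̅T̅
      ≡⟨ cong (_+ size S̅T̅) (∑.∑-distrib-+ (χ ∘ S) (χ ∘ T)) ⟨
    ∑.sum (λ u → χ (S u) + χ (T u)) + size S̅T̅
      ≡⟨ ∑.∑-distrib-+ (λ u → χ (S u) + χ (T u)) (χ ∘ S̅T̅) ⟨
    ∑.sum (λ u → χ (S u) + χ (T u) + χ (S̅T̅ u))
      ≡⟨ ∑.sum-cong-≗ (λ u → pointwise (S u) (T u)) ⟩
    ∑.sum (λ u → 1 + χ (S u ∧ T u))
      ≡⟨ ∑.∑-distrib-+ {n} (const 1) (λ u → χ (S u ∧ T u)) ⟩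
    ∑.sum {n} (const 1) + size (λ u → S u ∧ T u)
      ≡⟨ cong (_+ size (λ u → S u ∧ T u)) (sum-one n) ⟩
    n + size (λ u → S u ∧ T u) ∎
    where
    open ≡-Reasoning
    S̅T̅ : Fin n → Bool
    S̅T̅ u = not (S u) ∧ not (T u)
    pointwise : ∀ s t → χ s + χ t + χ (not s ∧ not t) ≡ 1 + χ (s ∧ t)
    pointwise true  true  = refl
    pointwise true  false = refl
    pointwise false true  = refl
    pointwise false false = refl

  degreeSum≤ : ∀ P c → degreeSum P ≤ size P * c + ∑.sum (λ u → degree G u ∸ c)
  degreeSum≤ P c = begin
    degreeSum P                                                  ≤⟨ sum-mono (λ u → pointwise (P u) (degree G u)) ⟩
    ∑.sum (λ u → χ (P u) * c + (degree G u ∸ c))                 ≡⟨ ∑.∑-distrib-+ (λ u → χ (P u) * c) _ ⟩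
    ∑.sum (λ u → χ (P u) * c) + ∑.sum (λ u → degree G u ∸ c)     ≡⟨
      cong (_+ ∑.sum (λ u → degree G u ∸ c)) (∑.*-distribʳ-sum c (χ ∘ P)) ⟨
    size P * c + ∑.sum (λ u → degree G u ∸ c)                    ∎
    where
    open ≤-Reasoning
    pointwise : ∀ b d → χ b * d ≤ χ b * c + (d ∸ c)
    pointwise false d = z≤n
    pointwise true  d = ≤-trans (≤-reflexive (+-identityʳ d))
      (≤-trans (m≤n+m∸n d c) (≤-reflexive (cong (_+ (d ∸ c)) (sym (+-identityʳ c)))))

-- Vertex sets as predicates and as cards

Selects : (Fin n → A) → (Fin n → Bool) → Vec A k → Set
Selects g P S = ∀ f → sumOver f (toList S) ≡ ∑.sum (λ i → χ (P i) * f (g i))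

combinations-∷⁺ : ∀ k {Q : Vec A k → Set} x xs → Any Q (combinations k xs) → Any Q (combinations k (x ∷ xs))
combinations-∷⁺ zero    x xs q = q
combinations-∷⁺ (suc k) x xs q = Any.++⁺ʳ (map (x ∷_) (combinations k xs)) q

combinations-complete : ∀ (g : Fin n → A) P → Any (Selects g P) (combinations (∑.sum (χ ∘ P)) (List.tabulate g))
combinations-complete {zero}  g P = here λ f → refl
combinations-complete {suc n} g P with P zero
... | true  = Any.++⁺ˡ (Any.map⁺ (Any.map (λ sel f → cong₂ _+_ (sym (*-identityˡ (f (g zero)))) (sel f))
                (combinations-complete (g ∘ suc) (P ∘ suc))))
... | false = combinations-∷⁺ (∑.sum (χ ∘ P ∘ suc)) (g zero) (List.tabulate (g ∘ suc))
                (combinations-complete (g ∘ suc) (P ∘ suc))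

combinations-sound : ∀ k (g : Fin n → A) → All (λ S → ∃ λ P → Selects g P S) (combinations k (List.tabulate g))
combinations-sound {n}     zero    g = (const false , λ f → sym (∑.sum-replicate-zero n)) ∷ []
combinations-sound {zero}  (suc k) g = []
combinations-sound {suc n} (suc k) g = All.++⁺
  (All.map⁺ (All.map (λ (P , sel) → (λ { zero → true ; (suc i) → P i }) ,
    λ f → cong₂ _+_ (sym (*-identityˡ (f (g zero)))) (sel f)) (combinations-sound k (g ∘ suc))))
  (All.map (λ (P , sel) → (λ { zero → false ; (suc i) → P i }) , sel) (combinations-sound (suc k) (g ∘ suc)))

edgeCount : Graph n → ℕ
edgeCount {n} K = ∑.sum (λ u → ∑.sum (λ v → χ (adj K u v)))

edgeCount-≅ : ∀ {K L : Graph n} → K ≅ L → edgeCount K ≡ edgeCount L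
edgeCount-≅ {K = K} {L} e = trans (∑.sum-cong-≗ (λ u → sym (degree-∑ K u)))
  (trans (trans (∑.sum-cong-≗ (degree-≅ e)) (sym (∑.sum-permute (degree L) (bij e)))) (∑.sum-cong-≗ (degree-∑ L)))

edgeCount-induced : ∀ (G : Graph n) P (S : Vec (Fin n) k) → Selects id P S → edgeCount (induced G S) ≡ edges G P P
edgeCount-induced G P S sel = begin
  ∑.sum (λ i → ∑.sum (λ j → χ (adj G (lookup S i) (lookup S j))))
    ≡⟨ ∑.sum-cong-≗ (λ i → trans (sym (sumOver-toList (χ ∘ adj G (lookup S i)) S)) (sel (χ ∘ adj G (lookup S i)))) ⟩
  ∑.sum (λ i → row (lookup S i))
    ≡⟨ sumOver-toList row S ⟨
  sumOver row (toList S)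
    ≡⟨ sel row ⟩
  edges G P P ∎
  where
  open ≡-Reasoning
  row : Fin _ → ℕ
  row u = ∑.sum (λ v → χ (P v) * χ (adj G u v))

size-selected : ∀ (G : Graph n) P (S : Vec (Fin n) k) → Selects id P S → size G P ≡ k
size-selected G P S sel = trans (∑.sum-cong-≗ (λ i → sym (*-identityʳ (χ (P i))))) (trans (sym (sel (const 1))) (ones S))
  where
  ones : ∀ {k} (S : Vec _ k) → sumOver (const 1) (toList S) ≡ k
  ones []      = refl
  ones (_ ∷ S) = cong suc (ones S)

-- Since `edges` counts ordered pairs, `HasSet G 4 12` is a 4-clique and `HasSet G 4 0` an
-- independent 4-set.
HasSet : Graph n → (k e : ℕ) → Set
HasSet G k e = ∃ λ P → size G P ≡ k × edges G P P ≡ e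

-- The set gives a card of `G`, an isomorphic card occurs in the deck of `H`, and isomorphism
-- preserves the edge count.
SameDeck⇒HasSet : ∀ (G H : Graph n) {k e} → SameDeck k G H → HasSet G k e → HasSet H k e
SameDeck⇒HasSet {n} G H {e = e} same (P , refl , refl) = conclude (All.lookupAny (combinations-sound (size G P) id) inH)
  where
  inG : Any (λ K → edgeCount K ≡ e) (deck (size G P) G)
  inG = Any.map⁺ (Any.map (λ {S} sel → edgeCount-induced G P S sel) (combinations-complete id P))
  inH : Any (λ S → edgeCount (induced H S) ≡ e) (kSubsets (size G P) n)
  inH = Any.map⁻ (Setoid↭.Any-resp-↭ (≅-setoid (size G P)) (λ iso eq → trans (sym (edgeCount-≅ iso)) eq) same inG)
  S : Vec (Fin n) (size G P)
  S = Any.lookup inH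
  conclude : (∃ λ Q → Selects id Q S) × edgeCount (induced H S) ≡ e → HasSet H (size G P) e
  conclude ((Q , sel) , eq) = Q , size-selected H Q S sel , trans (sym (edgeCount-induced H Q S sel)) eq

sumOver-degreeList : ∀ (f : ℕ → ℕ) (G : Graph n) → sumOver f (degreeList G) ≡ ∑.sum (f ∘ degree G)
sumOver-degreeList {n} f G = trans (sumOver-map f (degree G) (allFin n)) (sumOver-allFin (f ∘ degree G))

degreeSum-total : ∀ (G : Graph n) P → degreeSum G P + degreeSum G (not ∘ P) ≡ ∑.sum (degree G)
degreeSum-total G P = trans (sym (∑.∑-distrib-+ (λ u → χ (P u) * degree G u) _))
  (∑.sum-cong-≗ (λ u → trans (sym (*-distribʳ-+ (degree G u) (χ (P u)) (χ (not (P u)))))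
    (trans (cong (_* degree G u) (χ-not (P u))) (*-identityˡ (degree G u)))))

-- A 4-clique S and an independent 4-set T cover the seven vertices, so V ∖ S is independent and S has degree sum
-- 12 more than V ∖ S.
clique-degreeSum : n ≤ 7 → ∀ (G : Graph n) → HasSet G 4 12 → HasSet G 4 0 →
  ∑.sum (degree G) + 12 ≤ 2 * (12 + ∑.sum (λ u → degree G u ∸ 3))
clique-degreeSum n≤7 G (S , ∣S∣ , eS) (T , ∣T∣ , eT) = begin
  ∑.sum (degree G) + 12                           ≡⟨ cong (_+ 12) (degreeSum-total G S) ⟨
  degreeSum G S + degreeSum G (not ∘ S) + 12      ≡⟨ +-assoc (degreeSum G S) _ 12 ⟩
  degreeSum G S + (degreeSum G (not ∘ S) + 12)    ≡⟨ cong (λ x → degreeSum G S + (degreeSum G (not ∘ S) + x)) eS ⟨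
  degreeSum G S + (degreeSum G (not ∘ S) + edges G S S)    ≡⟨ cong (degreeSum G S ℕ.+_) (degreeSum-balance G S) ⟨
  degreeSum G S + (degreeSum G S + edges G (not ∘ S) (not ∘ S))    ≤⟨ +-monoʳ-≤ (degreeSum G S) (+-monoʳ-≤ (degreeSum G S)
                                                                        (≤-trans (edges-mono G S̅≤T) (≤-reflexive eT))) ⟩
  2 * degreeSum G S                               ≤⟨ *-monoʳ-≤ 2 (degreeSum≤ G S 3) ⟩
  2 * (size G S * 3 + ∑.sum (λ u → degree G u ∸ 3)) ≡⟨ cong (λ x → 2 * (x * 3 + ∑.sum (λ u → degree G u ∸ 3))) ∣S∣ ⟩
  2 * (12 + ∑.sum (λ u → degree G u ∸ 3))         ∎
  where
  open ≤-Reasoning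
  S̅T̅ : Fin _ → Bool
  S̅T̅ u = not (S u) ∧ not (T u)
  S̅T̅≡∅ : size G S̅T̅ ≡ 0
  -- Inclusion-exclusion: 4 + 4 plus the number of uncovered vertices is at most 7 + 1.
  S̅T̅≡∅ = n≤0⇒n≡0 (+-cancelˡ-≤ 8 _ _ (begin
    8 + size G S̅T̅                             ≡⟨ cong₂ (λ x y → x + y + size G S̅T̅) ∣S∣ ∣T∣ ⟨
    size G S + size G T + size G S̅T̅           ≡⟨ size-inclusion-exclusion G S T ⟩
    _ + size G (λ u → S u ∧ T u)              ≤⟨ +-mono-≤ n≤7 (clique∩independent G S T
                                                   (trans (cong₂ _+_ eS ∣S∣) (sym (cong₂ _*_ ∣S∣ ∣S∣))) eT) ⟩
    8                                         ∎))
  S̅≤T : ∀ u → χ (not (S u)) ≤ χ (T u)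
  S̅≤T u = go (S u) (T u) (≤-trans (term≤sum (χ ∘ S̅T̅) u) (≤-reflexive S̅T̅≡∅))
    where
    go : ∀ s t → χ (not s ∧ not t) ≤ 0 → χ (not s) ≤ χ t
    go true  t     _ = z≤n
    go false true  _ = ≤-refl
    go false false ()

-- The split exceptions for n = 7

distinct : ∀ {p} → p ≡ 1 ⊎ p ≡ 2 → multiplicity (3 + p) (replicate 3 p) ≡ 0
distinct (inj₁ refl) = refl
distinct (inj₂ refl) = refl

splitDegrees : (p z : ℕ) → List ℕ
splitDegrees p z = p ∷ p ∷ p ∷ 3 + p ∷ 3 + p ∷ 3 + p ∷ z ∷ []

splitDegrees-↭ : ∀ p ds → p ≡ 1 ⊎ p ≡ 2 → length ds ≡ 7 → 3 ≤ multiplicity p ds → 3 ≤ multiplicity (3 + p) ds →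
  ∃ λ z → ds ↭ splitDegrees p z
splitDegrees-↭ p ds p≡ ∣ds∣ p≤ q≤ with extract 3 p ds p≤
... | ds′ , ds↭ with extract 3 (3 + p) ds′ (≤-trans q≤ (≤-reflexive (trans
                       (sumOver-↭-≡ (χ ∘ (_≡ᵇ (3 + p))) ds↭)
                       (trans (sumOver-++ (χ ∘ (_≡ᵇ (3 + p))) (replicate 3 p) ds′)
                         (cong (_+ multiplicity (3 + p) ds′) (distinct p≡))))))
... | ds″ , ds′↭ = single ds″ (↭-trans ds↭ (++⁺ˡ (replicate 3 p) ds′↭))
  where
  single : ∀ es → ds ↭ replicate 3 p ++ replicate 3 (3 + p) ++ es → ∃ λ z → ds ↭ splitDegrees p z
  single []           ds↭ = contradiction (trans (sym (↭-length ds↭)) ∣ds∣) λ ()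
  single (z ∷ [])     ds↭ = z , ds↭
  single (_ ∷ _ ∷ _)  ds↭ = contradiction (trans (sym (↭-length ds↭)) ∣ds∣) λ ()

module _ (H : Graph n) {L : List ℕ} (degrees : degreeList H ↭ L) where

  ∑-degree : ∀ f → ∑.sum (f ∘ degree H) ≡ sumOver f L
  ∑-degree f = trans (sym (sumOver-degreeList f H)) (sumOver-↭-≡ f degrees)

  -- For a set of vertices chosen by degree, every term except the edge count can be computed from
  -- the degree list.
  ErdősGallai-list : ∀ t → let Q = t ∘ degree H in
    sumOver (λ d → χ (t d) * d) L + sumOver (χ ∘ t) L + edges H (not ∘ Q) (not ∘ Q)
    ≤ sumOver (λ d → χ (not (t d)) * d) L + sumOver (χ ∘ t) L * sumOver (χ ∘ t) L
  ErdősGallai-list t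
    rewrite sym (∑-degree (χ ∘ t)) | sym (∑-degree (λ d → χ (t d) * d)) | sym (∑-degree (λ d → χ (not (t d)) * d))
    = ErdősGallai H (t ∘ degree H)

  balance-list : ∀ t → let Q = t ∘ degree H in
    sumOver (λ d → χ (t d) * d) L + edges H (not ∘ Q) (not ∘ Q) ≡ sumOver (λ d → χ (not (t d)) * d) L + edges H Q Q
  balance-list t rewrite sym (∑-degree (λ d → χ (t d) * d)) | sym (∑-degree (λ d → χ (not (t d)) * d))
    = degreeSum-balance H (t ∘ degree H)

  ErdősGallai-list-≤ : ∀ t → sumOver (λ d → χ (t d) * d) L + sumOver (χ ∘ t) L
    ≤ sumOver (λ d → χ (not (t d)) * d) L + sumOver (χ ∘ t) L * sumOver (χ ∘ t) L
  ErdősGallai-list-≤ t = m+n≤o⇒m≤o _ (ErdősGallai-list t)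

-- Erdős-Gallai for the vertices of degree at least 4 excludes z < 3, and also z > 3, where `z`
-- itself joins them. At z = 3 it is tight, so the other four vertices are independent.
split-structure : ∀ (H : Graph n) p z → p ≡ 1 ⊎ p ≡ 2 → degreeList H ↭ splitDegrees p z →
  z ≡ 3 × HasSet H 4 12 × HasSet H 4 0
split-structure H _ 0 (inj₁ refl) ds = contradiction (ErdősGallai-list-≤ H ds (4 ≤ᵇ_)) (from-no (15 ≤? 12))
split-structure H _ 0 (inj₂ refl) ds = contradiction (ErdősGallai-list-≤ H ds (4 ≤ᵇ_)) (from-no (18 ≤? 15))
split-structure H _ 1 (inj₁ refl) ds = contradiction (ErdősGallai-list-≤ H ds (4 ≤ᵇ_)) (from-no (15 ≤? 13))
split-structure H _ 1 (inj₂ refl) ds = contradiction (ErdősGallai-list-≤ H ds (4 ≤ᵇ_)) (from-no (18 ≤? 16))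
split-structure H _ 2 (inj₁ refl) ds = contradiction (ErdősGallai-list-≤ H ds (4 ≤ᵇ_)) (from-no (15 ≤? 14))
split-structure H _ 2 (inj₂ refl) ds = contradiction (ErdősGallai-list-≤ H ds (4 ≤ᵇ_)) (from-no (18 ≤? 17))
split-structure H _ (suc (suc (suc (suc z)))) (inj₁ refl) ds = contradiction
  (≤-trans (+-monoˡ-≤ 4 (m≤m+n 16 (z + 0 + 0))) (ErdősGallai-list-≤ H ds (4 ≤ᵇ_))) (from-no (20 ≤? 19))
split-structure H _ (suc (suc (suc (suc z)))) (inj₂ refl) ds = contradiction
  (≤-trans (+-monoˡ-≤ 4 (m≤m+n 19 (z + 0 + 0))) (ErdősGallai-list-≤ H ds (4 ≤ᵇ_))) (from-no (23 ≤? 22))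
split-structure H p 3 p≡ ds = refl , (S , ∣S∣ p≡ ds , eS) , (T , ∣T∣ p≡ ds , eT p≡ ds)
  where
  ∣S∣ : p ≡ 1 ⊎ p ≡ 2 → degreeList H ↭ splitDegrees p 3 → ∑.sum (χ ∘ (3 ≤ᵇ_) ∘ degree H) ≡ 4
  ∣S∣ (inj₁ refl) ds = ∑-degree H ds (χ ∘ (3 ≤ᵇ_))
  ∣S∣ (inj₂ refl) ds = ∑-degree H ds (χ ∘ (3 ≤ᵇ_))
  ∣T∣ : p ≡ 1 ⊎ p ≡ 2 → degreeList H ↭ splitDegrees p 3 → ∑.sum (χ ∘ not ∘ (4 ≤ᵇ_) ∘ degree H) ≡ 4
  ∣T∣ (inj₁ refl) ds = ∑-degree H ds (χ ∘ not ∘ (4 ≤ᵇ_))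
  ∣T∣ (inj₂ refl) ds = ∑-degree H ds (χ ∘ not ∘ (4 ≤ᵇ_))
  S T : Fin _ → Bool
  S = (3 ≤ᵇ_) ∘ degree H
  T = not ∘ (4 ≤ᵇ_) ∘ degree H
  eT : p ≡ 1 ⊎ p ≡ 2 → degreeList H ↭ splitDegrees p 3 → edges H T T ≡ 0
  eT (inj₁ refl) ds = n≤0⇒n≡0 (+-cancelˡ-≤ 15 _ _ (ErdősGallai-list H ds (4 ≤ᵇ_)))
  eT (inj₂ refl) ds = n≤0⇒n≡0 (+-cancelˡ-≤ 18 _ _ (ErdősGallai-list H ds (4 ≤ᵇ_)))
  -- The vertices of degree at least 3 have degree sum 12 above that of the rest; by the balance of
  -- degree sums they span all 12 ordered pairs.
  12≤eS : p ≡ 1 ⊎ p ≡ 2 → degreeList H ↭ splitDegrees p 3 → 12 ≤ edges H S S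
  12≤eS (inj₁ refl) ds = +-cancelˡ-≤ 3 _ _ (≤-trans (m≤m+n 15 _) (≤-reflexive (balance-list H ds (3 ≤ᵇ_))))
  12≤eS (inj₂ refl) ds = +-cancelˡ-≤ 6 _ _ (≤-trans (m≤m+n 18 _) (≤-reflexive (balance-list H ds (3 ≤ᵇ_))))
  eS : edges H S S ≡ 12
  eS = ≤-antisym (+-cancelʳ-≤ 4 _ _ (subst (λ s → edges H S S + s ≤ s * s) (∣S∣ p≡ ds) (edges+size≤ H S))) (12≤eS p≡ ds)

length-degreeList : ∀ (G : Graph n) → length (degreeList G) ≡ n
length-degreeList {n} G = trans (length-map (degree G) (allFin n)) (length-tabulate {n = n} id)

multiplicity-vertex : ∀ (G : Graph n) d → 0 < multiplicity d (degreeList G) → ∃ λ v → degree G v ≡ d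
multiplicity-vertex G d pos with v , _ , eq ← ∈-map⁻ (degree G) (multiplicity-∈ (degreeList G) pos) = v , sym eq

no-exception : n ≡ 7 → ∀ (G H : Graph n) → SameDeck 4 H G → ¬ Exception (degreeList G) (degreeList H)
no-exception n≡7 G H same (extreme 0∈ 6∈) =
  let u , du = multiplicity-vertex G 0 0∈
      v , dv = multiplicity-vertex G 6 6∈
  in contradiction (≤-trans (≤-reflexive (cong (_+ 2) (sym dv)))
       (≤-trans (isolated⇒degree≤n-2 G u v du (subst (0 <_) (sym dv) (s≤s z≤n))) (≤-reflexive n≡7))) (from-no (8 ≤? 7))
no-exception n≡7 G H same (split p p≡ p≤ q≤ sum≡ excess≡) =
  let z , ds = splitDegrees-↭ p (degreeList H) p≡ (trans (length-degreeList H) n≡7) p≤ q≤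
      z≡3 , clique , independent = split-structure H p z p≡ ds
  in too-large (∑.sum (λ u → degree G u ∸ 3))
       (subst (λ x → x + 12 ≤ 2 * (12 + ∑.sum (λ u → degree G u ∸ 3)))
         (total≡ (subst (λ z → degreeList H ↭ splitDegrees p z) z≡3 ds))
         (clique-degreeSum (≤-reflexive n≡7) G (SameDeck⇒HasSet H G same clique) (SameDeck⇒HasSet H G same independent)))
  where
  open ≡-Reasoning
  -- In `H` the degree sum is 12 plus twice the total excess over 3. `G` has the same degree sum but
  -- an excess smaller by 1, which contradicts `clique-degreeSum`.
  splitDegrees-sum : p ≡ 1 ⊎ p ≡ 2 → sumOver id (splitDegrees p 3) ≡ 12 + 2 * sumOver (_∸ 3) (splitDegrees p 3)
  splitDegrees-sum (inj₁ refl) = refl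
  splitDegrees-sum (inj₂ refl) = refl
  total≡ : degreeList H ↭ splitDegrees p 3 → ∑.sum (degree G) ≡ 12 + 2 * suc (∑.sum (λ u → degree G u ∸ 3))
  total≡ ds = begin
    ∑.sum (degree G)                              ≡⟨ sumOver-degreeList id G ⟨
    sumOver id (degreeList G)                     ≡⟨ sum≡ ⟩
    sumOver id (degreeList H)                     ≡⟨ sumOver-↭-≡ id ds ⟩
    sumOver id (splitDegrees p 3)                 ≡⟨ splitDegrees-sum p≡ ⟩
    12 + 2 * sumOver (_∸ 3) (splitDegrees p 3)    ≡⟨ cong (λ x → 12 + 2 * x) (trans excess≡ (sumOver-↭-≡ (_∸ 3) ds)) ⟨
    12 + 2 * suc (sumOver (_∸ 3) (degreeList G))  ≡⟨ cong (λ x → 12 + 2 * suc x) (sumOver-degreeList (_∸ 3) G) ⟩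
    12 + 2 * suc (∑.sum (λ u → degree G u ∸ 3))   ∎
  too-large : ∀ x → ¬ 12 + 2 * suc x + 12 ≤ 2 * (12 + x)
  too-large x le = m+1+n≰m (2 * (12 + x)) (≤-trans (≤-reflexive (identity x)) le)
    where
    identity : ∀ x → 2 * (12 + x) + 2 ≡ 12 + 2 * suc x + 12
    identity = solve-∀

-- Six vertices

graph₃ : (a b c : Bool) → Graph 3
graph₃ a b c = record
  { adj        = edge
  ; adj-sym    = λ { 0F 0F → refl ; 0F 1F → refl ; 0F 2F → refl
                   ; 1F 0F → refl ; 1F 1F → refl ; 1F 2F → refl
                   ; 2F 0F → refl ; 2F 1F → refl ; 2F 2F → refl }
  ; adj-irrefl = λ { 0F → refl ; 1F → refl ; 2F → refl }
  }
  where
  edge : Fin 3 → Fin 3 → Bool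
  edge 0F 1F = a
  edge 1F 0F = a
  edge 0F 2F = b
  edge 2F 0F = b
  edge 1F 2F = c
  edge 2F 1F = c
  edge _  _  = false

≅-graph₃ : ∀ K → K ≅ graph₃ (adj K 0F 1F) (adj K 0F 2F) (adj K 1F 2F)
≅-graph₃ K = record { bij = idₚ ; adj-pres = λ
  { 0F 0F → adj-irrefl K 0F ; 0F 1F → refl            ; 0F 2F → refl
  ; 1F 0F → adj-sym K 1F 0F ; 1F 1F → adj-irrefl K 1F ; 1F 2F → refl
  ; 2F 0F → adj-sym K 2F 0F ; 2F 1F → adj-sym K 2F 1F ; 2F 2F → adj-irrefl K 2F } }

edgeCount₃ : Graph 3 → ℕ
edgeCount₃ K = χ (adj K 0F 1F) + (χ (adj K 0F 2F) + χ (adj K 1F 2F))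

standard₃ : ℕ → Graph 3
standard₃ 0 = graph₃ false false false
standard₃ 1 = graph₃ true  false false
standard₃ 2 = graph₃ true  true  false
standard₃ _ = graph₃ true  true  true

≅-via : ∀ {n} {K L : Graph n} (π : Permutation n n) →
  {True (all? λ u → all? λ v → adj K u v ≟ᵇ adj L (π ⟨$⟩ʳ u) (π ⟨$⟩ʳ v))} → K ≅ L
≅-via π {preserved} = record { bij = π ; adj-pres = toWitness preserved }

≅-standard₃ : ∀ K → K ≅ standard₃ (edgeCount₃ K)
≅-standard₃ K = ≅-trans (≅-graph₃ K) (go (adj K 0F 1F) (adj K 0F 2F) (adj K 1F 2F))
  where
  go : ∀ a b c → graph₃ a b c ≅ standard₃ (χ a + (χ b + χ c))
  go false false false = ≅-refl
  go true  false false = ≅-refl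
  go false true  false = ≅-via (transpose 1F 2F)
  go false false true  = ≅-via (transpose 0F 2F)
  go true  true  false = ≅-refl
  go true  false true  = ≅-via (transpose 0F 1F)
  go false true  true  = ≅-via (transpose 0F 2F)
  go true  true  true  = ≅-refl

-- On three vertices the number of edges determines the isomorphism type, so decks can be compared
-- as lists of numbers.
edgeCount₃-↭ : ∀ Ks Ls → map edgeCount₃ Ks ↭ map edgeCount₃ Ls → Homogeneous.Permutation _≅_ Ks Ls
edgeCount₃-↭ Ks Ls p = Homogeneous.trans (Homogeneous.refl (standardise Ks)) (Homogeneous.trans
  (Setoid↭.map⁺ (setoid ℕ) (≅-setoid 3) (λ { refl → ≅-refl }) (↭⇒↭ₛ p))
  (Homogeneous.sym ≅-sym (Homogeneous.refl (standardise Ls))))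
  where
  standardise : ∀ Ks → Pointwise _≅_ Ks (map standard₃ (map edgeCount₃ Ks))
  standardise []       = []
  standardise (K ∷ Ks) = ≅-standard₃ K ∷ standardise Ks

joins : ∀ {n} → List (Fin n × Fin n) → Fin n → Fin n → Bool
joins es u v = any (λ (x , y) → (isYes (u ≟ᶠ x) ∧ isYes (v ≟ᶠ y)) ∨ (isYes (u ≟ᶠ y) ∧ isYes (v ≟ᶠ x))) es

fromEdges : ∀ {n} (es : List (Fin n × Fin n)) →
  {True (all? λ u → all? λ v → joins es u v ≟ᵇ joins es v u)} → {True (all? λ v → joins es v v ≟ᵇ false)} → Graph n
fromEdges es {symmetric} {irreflexive} = record
  { adj = joins es ; adj-sym = toWitness symmetric ; adj-irrefl = toWitness irreflexive }

-- The degrees are 3, 1, 1, 1, 1, 1 and 2, 2, 2, 1, 1, 0. Both graphs have four edges, three pairs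
-- of adjacent edges and no triangle, hence 7, 10, 3 and 0 triples with 0, 1, 2 and 3 edges.
K₁,₃+K₂ P₅+K₁ : Graph 6
K₁,₃+K₂ = fromEdges ((0F , 1F) ∷ (0F , 2F) ∷ (0F , 3F) ∷ (4F , 5F) ∷ [])
P₅+K₁   = fromEdges ((0F , 1F) ∷ (1F , 2F) ∷ (2F , 3F) ∷ (3F , 4F) ∷ [])

same-3-deck : SameDeck 3 K₁,₃+K₂ P₅+K₁
same-3-deck = edgeCount₃-↭ (deck 3 K₁,₃+K₂) (deck 3 P₅+K₁) (multiplicity⇒↭ _ _ λ
  { 0 → refl ; 1 → refl ; 2 → refl ; 3 → refl ; (suc (suc (suc (suc _)))) → refl })

different-degrees : ¬ SameDegreeList K₁,₃+K₂ P₅+K₁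
different-degrees p = contradiction (sumOver-↭-≡ (χ ∘ (_≡ᵇ 0)) p) λ ()

-- From decks to degree lists

degreePair : ∀ m (G H : Graph (4 + m)) → SameDeck (suc m) G H → MomentPair (suc m)
degreePair m G H same = record
  { gs = degreeList G ; hs = degreeList H
  ; ∣gs∣ = length-degreeList G ; ∣hs∣ = length-degreeList H
  ; gs< = degrees< G ; hs< = degrees< H
  -- With n = 4 + m the cards have m + 1 vertices, which gives the moments of order at most m = n -
  -- 4.
  ; moments = λ {j} j<m → SameDeck⇒binomialMoment m j G H (s≤s⁻¹ j<m) (m≤n+m m 3) same
  }
  where
  degrees< : ∀ {n} (G : Graph n) → All (_< n) (degreeList G)
  degrees< G = All.map⁺ (All.tabulate⁺ (degree<n G))

SameDeck⇒SameDegreeList : ∀ m (G H : Graph (7 + m)) → SameDeck (4 + m) G H → SameDegreeList G H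
SameDeck⇒SameDegreeList 0 G H same =
  [ id , [ ⊥-elim ∘ no-exception refl G H (Homogeneous.sym ≅-sym same) , ⊥-elim ∘ no-exception refl H G same ]′ ]′
    (n≡7⇒↭⊎Exception (degreePair 3 G H same))
SameDeck⇒SameDegreeList 1 G H same = n≡8⇒↭ (degreePair 4 G H same)
SameDeck⇒SameDegreeList 2 G H same = n≡9⇒↭ (degreePair 5 G H same)
SameDeck⇒SameDegreeList (suc (suc (suc m))) G H same = n≥10⇒↭ m (degreePair (6 + m) G H same)

theorem1p7 : ((n : ℕ) → 7 ≤ n → (G H : Graph n) → SameDeck (n ∸ 3) G H → SameDegreeList G H)
    × (Σ[ G ∈ Graph 6 ] Σ[ H ∈ Graph 6 ] (SameDeck 3 G H × ¬ SameDegreeList G H))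
theorem1p7 = large , K₁,₃+K₂ , P₅+K₁ , same-3-deck , different-degrees
  where
  large : (n : ℕ) → 7 ≤ n → (G H : Graph n) → SameDeck (n ∸ 3) G H → SameDegreeList G H
  -- Matching on `7 ≤ n` replaces n by 7 + m, so that `n ∸ 3` computes to `4 + m`.
  large _ (s≤s (s≤s (s≤s (s≤s (s≤s (s≤s (s≤s (z≤n {m})))))))) = SameDeck⇒SameDegreeList m
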